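{- Let $k$ be a positive integer and, for each $n\ge 1$, let $w_{n,k}$ denote the number of words $w_1\cdots w_n$ with all $w_i\in[n]$ that contain no strictly decreasing subsequence of length $k+1$ (i.e. there are no indices $i_1<\dots<i_{k+1}$ with $w_{i_1}>w_{i_2}>\dots>w_{i_{k+1}}$). Then the limit $\lim_{n\to\infty} w_{n,k}^{1/n}$ exists and \[\limsup_{n\to\infty} w_{n,k}^{1/n} = \frac{(k+1)^{k+1}}{k^{k-1}}.\]
   Context: $[n]=\{1,2,\dots,n\}$. -}

module Defs where

open import Data.Fin as Fin using (Fin; finToFun; funToFin)
open import Data.Fin.Properties as Finₚ using (finToFun-funToFin)
open import Data.Integer using (+_)
open import Data.List using (length; filter; allFin)
open import Data.Nat as ℕ using (ℕ; zero; suc; NonZero)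
open import Data.Nat.Properties using (m^n≢0)
open import Data.Product using (Σ; ∃; _×_; _,_)
open import Data.Rational hiding (NonZero)
open import Data.Rational.Properties
open import Data.Rational.Solver using (module +-*-Solver)
open import Data.Sum using (_⊎_; inj₁; inj₂)
open import Function using (_∘_; _⇔_; mk⇔; module Equivalence)
open import Level using (0ℓ)
open import Relation.Binary using (Monotonic₁; Rel)
open import Relation.Binary.PropositionalEquality
open import Relation.Nullary using (Dec; yes; no; ¬_)
open import Relation.Nullary.Decidable using (map′; ¬?; _×-dec_; _→-dec_)
open import Relation.Unary using (Pred)
open import Algebra.Definitions.RawSemiring +-*-rawSemiring using (_^_)

-- Words of length n over [m].  The letter i of [m] is represented by the
-- element i - 1 of Fin m; only the order of the letters matters.

Word : ℕ → ℕ → Set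
Word m n = Fin n → Fin m

HasDecreasing : ∀ {m n} → ℕ → Word m n → Set
HasDecreasing {m} {n} l w =
  ∃ λ (i : Fin l → Fin n) →
    Monotonic₁ Fin._<_ Fin._<_ i × Monotonic₁ Fin._<_ Fin._>_ (w ∘ i)

private
  monotonic? : ∀ {l m} {_∼_ : Rel (Fin m) 0ℓ} →
               (∀ x y → Dec (x ∼ y)) →
               (f : Fin l → Fin m) → Dec (Monotonic₁ Fin._<_ _∼_ f)
  monotonic? _∼?_ f =
    map′ (λ h {x} {y} → h x y) (λ h x y → h {x} {y})
      (Finₚ.all? λ x → Finₚ.all? λ y → (x Finₚ.<? y) →-dec (f x ∼? f y))

hasDecreasing? : ∀ {m n} l (w : Word m n) → Dec (HasDecreasing l w)
hasDecreasing? {m} {n} l w =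
  map′ (λ (c , h) → finToFun c , h)
       (λ (i , inc , dec) → funToFin i ,
         (λ {x} {y} x<y → subst₂ Fin._<_
            (sym (finToFun-funToFin i x)) (sym (finToFun-funToFin i y)) (inc x<y)) ,
         (λ {x} {y} x<y → subst₂ (λ a b → w a Fin.> w b)
            (sym (finToFun-funToFin i x)) (sym (finToFun-funToFin i y)) (dec x<y)))
       (Finₚ.any? {n ℕ.^ l} λ c →
         monotonic? Finₚ._<?_ (finToFun c)
           ×-dec monotonic? (λ x y → y Finₚ.<? x) (w ∘ finToFun c))

-- `finToFun` is a bijection from Fin (n ^ n) onto the words of length n
-- over [n], so every such word is counted exactly once.

wordCount : ℕ → ℕ → ℕ
wordCount n k =
  length (filter (λ c → ¬? (hasDecreasing? (suc k) (finToFun {n} {n} c)))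
                 (allFin (n ℕ.^ n)))

-- Two-sided Dedekind cuts of ℚ.

record ℝ : Set₁ where
  field
    L U         : Pred ℚ 0ℓ
    inhabited-L : ∃ L
    inhabited-U : ∃ U
    rounded-L   : ∀ q → L q ⇔ (∃ λ r → q < r × L r)
    rounded-U   : ∀ q → U q ⇔ (∃ λ r → r < q × U r)
    disjoint    : ∀ q → ¬ (L q × U q)
    located     : ∀ {p q} → p < q → L p ⊎ U q

open ℝ

infix 4 _<ᵣ_

_<ᵣ_ : ℝ → ℝ → Set
x <ᵣ y = ∃ λ q → U x q × L y q

fromℚ : ℚ → ℝ
fromℚ s = record
  { L           = _< s
  ; U           = s <_
  ; inhabited-L = s - 1ℚ , subst (s - 1ℚ <_) (+-identityʳ s) (+-monoʳ-< s (negative⁻¹ (- 1ℚ)))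
  ; inhabited-U = s + 1ℚ , subst (_< s + 1ℚ) (+-identityʳ s) (+-monoʳ-< s (positive⁻¹ 1ℚ))
  ; rounded-L   = λ q → mk⇔ (λ q<s → let r , q<r , r<s = <-dense q<s in r , q<r , r<s)
                            (λ (r , q<r , r<s) → <-trans q<r r<s)
  ; rounded-U   = λ q → mk⇔ (λ s<q → let r , s<r , r<q = <-dense s<q in r , r<q , s<r)
                            (λ (r , r<q , s<r) → <-trans s<r r<q)
  ; disjoint    = λ q (q<s , s<q) → <-asym q<s s<q
  ; located     = λ {p} {q} → loc p q
  }
  where
  loc : ∀ p q → p < q → p < s ⊎ s < q
  loc p q p<q with p <? s
  ... | yes p<s = inj₁ p<s
  ... | no  p≮s = inj₂ (≤-<-trans (≮⇒≥ p≮s) p<q)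

private
  +-cancel : ∀ q ε → (q + ε) - ε ≡ q
  +-cancel = solve 2 (λ q ε → (q :+ ε) :- ε := q) refl
    where open +-*-Solver

  -+-cancel : ∀ q ε → (q - ε) + ε ≡ q
  -+-cancel = solve 2 (λ q ε → (q :- ε) :+ ε := q) refl
    where open +-*-Solver

infixl 6 _⊕_

_⊕_ : ℝ → ℚ → ℝ
x ⊕ ε = record
  { L           = L′
  ; U           = U′
  ; inhabited-L = let q , h = inhabited-L x in q + ε , subst (L x) (sym (+-cancel q ε)) h
  ; inhabited-U = let q , h = inhabited-U x in q + ε , subst (U x) (sym (+-cancel q ε)) h
  ; rounded-L   = λ q → mk⇔ (raiseL q) (lowerL q)
  ; rounded-U   = λ q → mk⇔ (lowerU q) (raiseU q)
  ; disjoint    = λ q → disjoint x (q - ε)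
  ; located     = λ {p} {q} p<q → located x {p - ε} {q - ε} (shift p<q)
  }
  where
  L′ U′ : Pred ℚ 0ℓ
  L′ q = L x (q - ε)
  U′ q = U x (q - ε)

  shift : ∀ {p q} → p < q → p - ε < q - ε
  shift {p} {q} = +-monoˡ-< (- ε) {p} {q}

  raiseL : ∀ q → L′ q → ∃ λ r → q < r × L′ r
  raiseL q h =
    let r , q-ε<r , Lr = Equivalence.to (rounded-L x (q - ε)) h in
    r + ε , subst (_< r + ε) (-+-cancel q ε) (+-monoˡ-< ε {q - ε} {r} q-ε<r)
          , subst (L x) (sym (+-cancel r ε)) Lr

  lowerL : ∀ q → (∃ λ r → q < r × L′ r) → L′ q
  lowerL q (r , q<r , h) = Equivalence.from (rounded-L x (q - ε)) (r - ε , shift q<r , h)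

  lowerU : ∀ q → U′ q → ∃ λ r → r < q × U′ r
  lowerU q h =
    let r , r<q-ε , Ur = Equivalence.to (rounded-U x (q - ε)) h in
    r + ε , subst (r + ε <_) (-+-cancel q ε) (+-monoˡ-< ε {r} {q - ε} r<q-ε)
          , subst (U x) (sym (+-cancel r ε)) Ur

  raiseU : ∀ q → (∃ λ r → r < q × U′ r) → U′ q
  raiseU q (r , r<q , h) = Equivalence.from (rounded-U x (q - ε)) (r - ε , shift r<q , h)

fromℕ : ℕ → ℚ
fromℕ m = + m / 1

private
  *-mono-≤ : ∀ {a b c d} → 0ℚ ≤ b → 0ℚ ≤ c → a ≤ c → b ≤ d → a * b ≤ c * d
  *-mono-≤ {a} {b} {c} {d} 0≤b 0≤c a≤c b≤d =
    ≤-trans (*-monoʳ-≤-nonNeg b {{nonNegative 0≤b}} a≤c)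
            (*-monoˡ-≤-nonNeg c {{nonNegative 0≤c}} b≤d)

  *-pos : ∀ {a b} → 0ℚ < a → 0ℚ < b → 0ℚ < a * b
  *-pos {a} {b} 0<a 0<b =
    positive⁻¹ _ {{pos*pos⇒pos a {{positive 0<a}} b {{positive 0<b}}}}

  *-nonNeg : ∀ {a b} → 0ℚ ≤ a → 0ℚ ≤ b → 0ℚ ≤ a * b
  *-nonNeg {a} {b} 0≤a 0≤b =
    nonNegative⁻¹ _ {{nonNeg*nonNeg⇒nonNeg a {{nonNegative 0≤a}} b {{nonNegative 0≤b}}}}

  0<- : ∀ {a b} → a < b → 0ℚ < b - a
  0<- {a} {b} a<b = subst (_< b - a) (+-inverseʳ a) (+-monoˡ-< (- a) a<b)

  <-+ : ∀ a {δ} → 0ℚ < δ → a < a + δ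
  <-+ a {δ} 0<δ = subst (_< a + δ) (+-identityʳ a) (+-monoʳ-< a 0<δ)

  -‿< : ∀ a {δ} → 0ℚ < δ → a - δ < a
  -‿< a {δ} 0<δ = subst (a - δ <_) (+-identityʳ a) (+-monoʳ-< a (neg-antimono-< 0<δ))

  divide : ∀ {d s} → 0ℚ < d → 0ℚ < s → ∃ λ δ → 0ℚ < δ × δ * s ≡ d
  divide {d} {s} 0<d 0<s =
    d * s⁻¹ , *-pos 0<d (positive⁻¹ s⁻¹ {{1/pos⇒pos s {{positive 0<s}}}}) ,
    trans (*-assoc d s⁻¹ s)
      (trans (cong (d *_) (*-inverseˡ s {{pos⇒nonZero s {{positive 0<s}}}})) (*-identityʳ d))
    where s⁻¹ = (1/ s) {{pos⇒nonZero s {{positive 0<s}}}}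

  ^-nonNeg : ∀ {q} n → 0ℚ ≤ q → 0ℚ ≤ q ^ n
  ^-nonNeg zero    0≤q = nonNegative⁻¹ 1ℚ
  ^-nonNeg (suc n) 0≤q = *-nonNeg 0≤q (^-nonNeg n 0≤q)

  ^-pos : ∀ {q} n → 0ℚ < q → 0ℚ < q ^ n
  ^-pos zero    0<q = positive⁻¹ 1ℚ
  ^-pos (suc n) 0<q = *-pos 0<q (^-pos n 0<q)

  ^-mono-≤ : ∀ {p q} n → 0ℚ ≤ p → p ≤ q → p ^ n ≤ q ^ n
  ^-mono-≤ zero    0≤p p≤q = ≤-refl
  ^-mono-≤ (suc n) 0≤p p≤q =
    *-mono-≤ (^-nonNeg n 0≤p) (≤-trans 0≤p p≤q) p≤q (^-mono-≤ n 0≤p p≤q)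

  ^-mono-< : ∀ {p q} n .{{_ : NonZero n}} → 0ℚ ≤ p → p < q → p ^ n < q ^ n
  ^-mono-< {p} {q} (suc n) 0≤p p<q =
    ≤-<-trans (*-monoˡ-≤-nonNeg p {{nonNegative 0≤p}} (^-mono-≤ n 0≤p (<⇒≤ p<q)))
              (*-monoˡ-<-pos (q ^ n) {{positive (^-pos n (≤-<-trans 0≤p p<q))}} p<q)

  enlarge : ∀ {a b c} → 0ℚ ≤ a → 0ℚ ≤ b → a * b < c →
            ∃ λ δ → 0ℚ < δ × (a + δ) * (b + δ) < c
  enlarge {a} {b} {c} 0≤a 0≤b ab<c =
    let δ , 0<δ , δs≡d = divide {d} {s} 0<d 0<s in
    δ , 0<δ , subst₂ _<_ (sym (expand a b δ)) total
                (+-monoʳ-< (a * b) {δ * (a + b + δ)} {d} (small δ 0<δ δs≡d))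
    where
    open +-*-Solver
    d s : ℚ
    d = c - a * b
    s = a + b + 1ℚ + d
    0<d : 0ℚ < d
    0<d = 0<- {a * b} {c} ab<c
    0≤a+b : 0ℚ ≤ a + b
    0≤a+b = +-mono-≤ {0ℚ} {a} {0ℚ} {b} 0≤a 0≤b
    0<a+b+1 : 0ℚ < a + b + 1ℚ
    0<a+b+1 = +-mono-≤-< {0ℚ} {a + b} {0ℚ} {1ℚ} 0≤a+b (positive⁻¹ 1ℚ)
    0<s : 0ℚ < s
    0<s = +-mono-< {0ℚ} {a + b + 1ℚ} {0ℚ} {d} 0<a+b+1 0<d
    d<s : d < s
    d<s = subst (_< s) (+-identityˡ d) (+-monoˡ-< d {0ℚ} {a + b + 1ℚ} 0<a+b+1)
    expand : ∀ a b δ → (a + δ) * (b + δ) ≡ a * b + δ * (a + b + δ)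
    expand = solve 3 (λ a b δ → (a :+ δ) :* (b :+ δ) := a :* b :+ δ :* (a :+ b :+ δ)) refl
    total : a * b + d ≡ c
    total = solve 2 (λ x c → x :+ (c :- x) := c) refl (a * b) c
    small : ∀ δ → 0ℚ < δ → δ * s ≡ d → δ * (a + b + δ) < d
    small δ 0<δ δs≡d = subst (δ * (a + b + δ) <_) δs≡d
      (*-monoʳ-<-pos δ {{positive 0<δ}} {a + b + δ} {s}
        (subst (_< s) (+-identityʳ (a + b + δ))
          (+-mono-< {a + b + δ} {a + b + 1ℚ} {0ℚ} {d} (+-monoʳ-< (a + b) {δ} {1ℚ} δ<1) 0<d)))
      where
      δ<1 : δ < 1ℚ
      δ<1 = *-cancelʳ-<-nonNeg s {{nonNegative (<⇒≤ 0<s)}} {δ} {1ℚ}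
              (subst₂ _<_ (sym δs≡d) (sym (*-identityˡ s)) d<s)

  shrink : ∀ {a b c} → 0ℚ < a → 0ℚ < b → 0ℚ ≤ c → c < a * b →
           ∃ λ δ → 0ℚ < δ × δ < a × δ < b × c < (a - δ) * (b - δ)
  shrink {a} {b} {c} 0<a 0<b 0≤c c<ab =
    let δ , 0<δ , δs≡d = divide {a * b - c} {a + b} (0<- {c} {a * b} c<ab) 0<a+b in
    δ , 0<δ
    , cancel δ a δs≡d
        (subst (a * b <_) (sum-a a b) (<-+ (a * b) {a * a} (*-pos {a} {a} 0<a 0<a)))
    , cancel δ b δs≡d
        (subst (a * b <_) (sum-b a b) (<-+ (a * b) {b * b} (*-pos {b} {b} 0<b 0<b)))
    , subst (c <_) (sym (expand δ δs≡d)) (<-+ c {δ * δ} (*-pos {δ} {δ} 0<δ 0<δ))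
    where
    open +-*-Solver
    0<a+b : 0ℚ < a + b
    0<a+b = +-mono-< {0ℚ} {a} {0ℚ} {b} 0<a 0<b
    sum-a : ∀ a b → a * b + a * a ≡ a * (a + b)
    sum-a = solve 2 (λ a b → a :* b :+ a :* a := a :* (a :+ b)) refl
    sum-b : ∀ a b → a * b + b * b ≡ b * (a + b)
    sum-b = solve 2 (λ a b → a :* b :+ b :* b := b :* (a :+ b)) refl
    d≤ab : a * b - c ≤ a * b
    d≤ab = subst (a * b - c ≤_) (+-identityʳ (a * b))
             (+-monoʳ-≤ (a * b) { - c} {0ℚ} (neg-antimono-≤ {0ℚ} {c} 0≤c))
    cancel : ∀ δ z → δ * (a + b) ≡ a * b - c → a * b < z * (a + b) → δ < z
    cancel δ z δs≡d h =
      *-cancelʳ-<-nonNeg (a + b) {{nonNegative (<⇒≤ 0<a+b)}} {δ} {z}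
        (subst (_< z * (a + b)) (sym δs≡d)
          (≤-<-trans {a * b - c} {a * b} {z * (a + b)} d≤ab h))
    expand : ∀ δ → δ * (a + b) ≡ a * b - c → (a - δ) * (b - δ) ≡ c + δ * δ
    expand δ δs≡d = begin
      (a - δ) * (b - δ)
        ≡⟨ solve 3 (λ a b δ → (a :- δ) :* (b :- δ) := a :* b :- δ :* (a :+ b) :+ δ :* δ)
                 refl a b δ ⟩
      a * b - δ * (a + b) + δ * δ
        ≡⟨ cong (λ z → a * b - z + δ * δ) δs≡d ⟩
      a * b - (a * b - c) + δ * δ
        ≡⟨ cong (_+ δ * δ) (solve 2 (λ x c → x :- (x :- c) := c) refl (a * b) c) ⟩
      c + δ * δ ∎
      where open ≡-Reasoning

  ^-enlarge : ∀ {q c} n → 0ℚ ≤ q → q ^ n < c → ∃ λ r → q < r × r ^ n < c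
  ^-enlarge {q} zero 0≤q h = q + 1ℚ , <-+ q (positive⁻¹ 1ℚ) , h
  ^-enlarge {q} {c} (suc n) 0≤q h =
    let δ , 0<δ , h′   = enlarge {q} {q ^ n} {c} 0≤q (^-nonNeg n 0≤q) h
        s , q<s , sⁿ< = ^-enlarge {q} {q ^ n + δ} n 0≤q (<-+ (q ^ n) {δ} 0<δ)
    in
    (q + δ) ⊓ s , q<r {s} {q + δ} q<s (<-+ q {δ} 0<δ)
    , bound ((q + δ) ⊓ s) {q + δ} {s} {q ^ n + δ}
        (≤-trans 0≤q (<⇒≤ (q<r {s} {q + δ} q<s (<-+ q {δ} 0<δ))))
        (p⊓q≤p (q + δ) s) (p⊓q≤q (q + δ) s) sⁿ< h′
    where
    q<r : ∀ {s t} → q < s → q < t → q < t ⊓ s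
    q<r {s} {t} q<s q<t with ⊓-sel t s
    ... | inj₁ e = subst (q <_) (sym e) q<t
    ... | inj₂ e = subst (q <_) (sym e) q<s

    bound : ∀ r {t s u} → 0ℚ ≤ r → r ≤ t → r ≤ s → s ^ n < u → t * u < c → r * r ^ n < c
    bound r {t} {s} {u} 0≤r r≤t r≤s sⁿ<u tu<c =
      ≤-<-trans {r * r ^ n} {t * u} {c}
        (*-mono-≤ {r} {r ^ n} {t} {u} (^-nonNeg n 0≤r) (≤-trans {0ℚ} {r} {t} 0≤r r≤t) r≤t
          (≤-trans {r ^ n} {s ^ n} {u} (^-mono-≤ n 0≤r r≤s) (<⇒≤ {s ^ n} {u} sⁿ<u)))
        tu<c

  ^-shrink : ∀ {q c} n → 0ℚ < q → 0ℚ ≤ c → c < q ^ n →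
             ∃ λ r → 0ℚ < r × r < q × c < r ^ n
  ^-shrink zero 0<q 0≤c h = let r , 0<r , r<q = <-dense 0<q in r , 0<r , r<q , h
  ^-shrink {q} {c} (suc n) 0<q 0≤c h =
    let δ , 0<δ , δ<q , δ<qⁿ , h′ = shrink {q} {q ^ n} {c} 0<q (^-pos n 0<q) 0≤c h
        0≤qⁿ-δ = <⇒≤ {0ℚ} {q ^ n - δ} (0<- {δ} {q ^ n} δ<qⁿ)
        s , 0<s , s<q , <sⁿ = ^-shrink {q} {q ^ n - δ} n 0<q 0≤qⁿ-δ (-‿< (q ^ n) {δ} 0<δ)
    in
    (q - δ) ⊔ s
    , <-≤-trans {0ℚ} {s} {(q - δ) ⊔ s} 0<s (p≤q⊔p (q - δ) s)
    , r<q {s} {q - δ} s<q (-‿< q {δ} 0<δ)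
    , bound ((q - δ) ⊔ s) {q - δ} {s} {q ^ n - δ} 0<s (p≤p⊔q (q - δ) s) (p≤q⊔p (q - δ) s) <sⁿ
        0≤qⁿ-δ h′
    where
    r<q : ∀ {s t} → s < q → t < q → t ⊔ s < q
    r<q {s} {t} s<q t<q with ⊔-sel t s
    ... | inj₁ e = subst (_< q) (sym e) t<q
    ... | inj₂ e = subst (_< q) (sym e) s<q

    bound : ∀ r {t s u} → 0ℚ < s → t ≤ r → s ≤ r → u < s ^ n → 0ℚ ≤ u →
            c < t * u → c < r * r ^ n
    bound r {t} {s} {u} 0<s t≤r s≤r u<sⁿ 0≤u c<tu =
      <-≤-trans {c} {t * u} {r * r ^ n} c<tu
        (*-mono-≤ {t} {u} {r} {r ^ n} 0≤u
          (≤-trans {0ℚ} {s} {r} (<⇒≤ {0ℚ} {s} 0<s) s≤r) t≤r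
          (≤-trans {u} {s ^ n} {r ^ n} (<⇒≤ {u} {s ^ n} u<sⁿ)
            (^-mono-≤ n (<⇒≤ {0ℚ} {s} 0<s) s≤r)))

  fromℕ-nonNeg : ∀ m → 0ℚ ≤ fromℕ m
  fromℕ-nonNeg m = nonNegative⁻¹ _ {{normalize-nonNeg m 1}}

  1≤⇒≤^ : ∀ {q} n .{{_ : NonZero n}} → 1ℚ ≤ q → q ≤ q ^ n
  1≤⇒≤^ {q} (suc n) 1≤q =
    subst (_≤ q * q ^ n) (*-identityʳ q)
      (*-monoˡ-≤-nonNeg q {{nonNegative (≤-trans (nonNegative⁻¹ 1ℚ) 1≤q)}} (1≤^ n))
    where
    1≤^ : ∀ n → 1ℚ ≤ q ^ n
    1≤^ zero    = ≤-refl
    1≤^ (suc n) = *-mono-≤ {1ℚ} {1ℚ} (nonNegative⁻¹ 1ℚ)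
      (≤-trans (nonNegative⁻¹ 1ℚ) 1≤q) 1≤q (1≤^ n)

-- The nonnegative n-th root of m.

root : (n : ℕ) .{{_ : NonZero n}} → ℕ → ℝ
root n m = record
  { L           = Lᵣ
  ; U           = Uᵣ
  ; inhabited-L = - 1ℚ , inj₁ (negative⁻¹ (- 1ℚ))
  ; inhabited-U = c + 1ℚ , upper
  ; rounded-L   = λ q → mk⇔ (raiseL q) (lowerL q)
  ; rounded-U   = λ q → mk⇔ (lowerU q) (raiseU q)
  ; disjoint    = disj
  ; located     = λ {p} {q} → loc p q
  }
  where
  c : ℚ
  c = fromℕ m

  0≤c : 0ℚ ≤ c
  0≤c = fromℕ-nonNeg m

  Lᵣ Uᵣ : Pred ℚ 0ℓ
  Lᵣ q = q < 0ℚ ⊎ q ^ n < c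
  Uᵣ q = 0ℚ < q × c < q ^ n

  raiseL : ∀ q → Lᵣ q → ∃ λ r → q < r × Lᵣ r
  raiseL q h with q <? 0ℚ | h
  ... | yes q<0 | _        = let r , q<r , r<0 = <-dense q<0 in r , q<r , inj₁ r<0
  ... | no  q≮0 | inj₁ q<0 with () ← q≮0 q<0
  ... | no  q≮0 | inj₂ h′  =
    let r , q<r , h″ = ^-enlarge n (≮⇒≥ q≮0) h′ in r , q<r , inj₂ h″

  lowerL : ∀ q → (∃ λ r → q < r × Lᵣ r) → Lᵣ q
  lowerL q (r , q<r , Lr) with q <? 0ℚ | Lr
  ... | yes q<0 | _        = inj₁ q<0
  ... | no  q≮0 | inj₁ r<0 = inj₁ (<-trans q<r r<0)
  ... | no  q≮0 | inj₂ h   = inj₂ (<-trans (^-mono-< n (≮⇒≥ q≮0) q<r) h)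

  lowerU : ∀ q → Uᵣ q → ∃ λ r → r < q × Uᵣ r
  lowerU q (0<q , h) =
    let r , 0<r , r<q , h′ = ^-shrink n 0<q 0≤c h in r , r<q , 0<r , h′

  raiseU : ∀ q → (∃ λ r → r < q × Uᵣ r) → Uᵣ q
  raiseU q (r , r<q , 0<r , h) =
    <-trans 0<r r<q , <-trans h (^-mono-< n (<⇒≤ 0<r) r<q)

  upper : Uᵣ (c + 1ℚ)
  upper = ≤-<-trans 0≤c c<c+1 , <-≤-trans c<c+1 (1≤⇒≤^ n 1≤c+1)
    where
    c<c+1 : c < c + 1ℚ
    c<c+1 = <-+ c (positive⁻¹ 1ℚ)
    1≤c+1 : 1ℚ ≤ c + 1ℚ
    1≤c+1 = subst (_≤ c + 1ℚ) (+-identityˡ 1ℚ) (+-monoˡ-≤ 1ℚ {0ℚ} {c} 0≤c)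

  disj : ∀ q → ¬ (Lᵣ q × Uᵣ q)
  disj q (inj₁ q<0 , 0<q , _) = <-asym q<0 0<q
  disj q (inj₂ h , _ , h′)    = <-asym h h′

  loc : ∀ p q → p < q → Lᵣ p ⊎ Uᵣ q
  loc p q p<q with p <? 0ℚ | c <? q ^ n
  ... | yes p<0 | _      = inj₁ (inj₁ p<0)
  ... | no  p≮0 | yes h  = inj₂ (≤-<-trans (≮⇒≥ p≮0) p<q , h)
  ... | no  p≮0 | no  ¬h = inj₁ (inj₂ (<-≤-trans (^-mono-< n (≮⇒≥ p≮0) p<q) (≮⇒≥ ¬h)))

Sequence : Set₁
Sequence = (n : ℕ) .{{_ : NonZero n}} → ℝ

-- Quantifying over rational ε only is no restriction, ℚ being dense in ℝ.

infix 4 _ConvergesTo_ _HasLimSup_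

_ConvergesTo_ : Sequence → ℝ → Set
a ConvergesTo ℓ =
  ∀ ε → 0ℚ < ε → ∃ λ N → ∀ n .{{_ : NonZero n}} → N ℕ.≤ n →
    (ℓ <ᵣ a n ⊕ ε) × (a n <ᵣ ℓ ⊕ ε)

-- ℓ = lim sup a: for every ε > 0, eventually a n < ℓ + ε, and ℓ < a n + ε
-- for infinitely many n.

_HasLimSup_ : Sequence → ℝ → Set
a HasLimSup ℓ =
  ∀ ε → 0ℚ < ε →
    (∃ λ N → ∀ n .{{_ : NonZero n}} → N ℕ.≤ n → a n <ᵣ ℓ ⊕ ε) ×
    (∀ N → ∃ λ n → Σ (NonZero n) λ n≢0 →
       N ℕ.≤ n × ℓ <ᵣ a n {{n≢0}} ⊕ ε)

growth : ℕ → Sequence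
growth k n = root n (wordCount n k)

growthRate : (k : ℕ) .{{_ : NonZero k}} → ℝ
growthRate k =
  fromℚ ((+ (suc k ℕ.^ suc k) / (k ℕ.^ (k ℕ.∸ 1))) {{m^n≢0 k (k ℕ.∸ 1)}})

{-# OPTIONS --safe #-}

-- Put R = (k + 1) ^ (k + 1) and T = k ^ (k - 1).
--
-- Upper bound.  Patience sorting distributes the letters of an avoider over k weakly increasing
-- piles.  Summed over all choices of a pile and a letter, one step multiplies the weight
-- ((k + 1) / k) ^ (number of letters that the piles still accept) by at most k * (k + 1); for words
-- of length n over [n] this gives at most (R / T) ^ n avoiders.
--
-- Lower bound.  Shuffle k weakly increasing words of length L, written in k disjoint intervals of
-- D = k * L + 1 letters, into a block of length k * L, and concatenate N blocks, shifting the
-- intervals by D from each block to the next.  Each colour class stays weakly increasing, the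
-- colours can be read off the letters, and only (N + k) * D letters are used.  The number of blocks
-- is a product of binomial coefficients that are, up to a polynomial factor in L, the largest terms
-- of binomial expansions, which gives (R / T) ^ (k * L).  Let N and then L tend to infinity.

module Submission where

open import Defs
open import Algebra.Bundles using (CommutativeRing)
open import Data.Empty using (⊥; ⊥-elim)
open import Data.Nat as ℕ using (ℕ; zero; suc; NonZero)
import Data.Nat.Properties as ℕₚ
open import Data.Product using (Σ; ∃; ∃₂; _×_; _,_; proj₁; proj₂)
open import Data.Sum using (_⊎_; inj₁; inj₂; [_,_]′)
open import Data.Unit using (⊤; tt)
open import Function using (_∘_; id; Injective)
open import Level using (0ℓ)
open import Relation.Binary using (Monotonic₁; Rel)
open import Relation.Binary.PropositionalEquality
open import Relation.Nullary using (¬_; yes; no; contradiction)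
open import Relation.Nullary.Decidable using (¬?)

module Counting where

  open import Data.Fin as Fin using (Fin; toℕ; fromℕ<; opposite; combine; remQuot; splitAt; finToFun; funToFin)
  import Data.Fin.Properties as Finₚ
  open import Data.List as List using (List; []; _∷_; _++_; map; concatMap; length; allFin; filter; downFrom)
  open import Data.List.Membership.Propositional using (_∈_)
  open import Data.List.Membership.Propositional.Properties
  open import Data.List.Properties using (length-++; length-map; map-++; map-∘; map-cong; length-tabulate)
  import Data.List.Relation.Unary.All as Listₐ
  open import Data.List.Relation.Unary.AllPairs using (_∷_)
  open import Data.List.Relation.Unary.Any as Any using (here)
  open import Data.List.Relation.Unary.Any.Properties using (lookup-index)
  open import Data.List.Relation.Unary.Unique.Propositional using (Unique)
  import Data.List.Relation.Unary.Unique.Propositional.Properties as Unique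
  open import Data.Nat
  open import Data.Nat.DivMod using (m%n<n; m*n/n≡m; /-monoˡ-≤; m≡m%n+[m/n]*n)
  open import Data.Nat.ListAction using (sum)
  open import Data.Nat.ListAction.Properties using (sum-++)
  open import Data.Nat.Properties
  open import Data.Nat.Tactic.RingSolver using (solve-∀)
  open import Data.Vec as Vec using (Vec; []; _∷_; tabulate; lookup)
  import Data.Vec.Properties as Vecₚ
  open import Data.Vec.Relation.Unary.All as All using (All; []; _∷_)
  import Data.Vec.Relation.Unary.All.Properties as Allₚ
  open import Data.Vec.Relation.Unary.AllPairs as AllPairs using (AllPairs; []; _∷_)
  import Data.Vec.Relation.Unary.AllPairs.Properties as AllPairsₚ

  -- Largest terms of binomial expansions

  -- The binomial coefficient of `a + b` over `a`, by Pascal's rule; `shuffle` decodes lattice paths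
  -- along the same recursion.
  paths : ℕ → ℕ → ℕ
  paths zero    b       = 1
  paths (suc a) zero    = 1
  paths (suc a) (suc b) = paths a (suc b) + paths (suc a) b

  -- Mutual induction: after Pascal's rule, the two identities for smaller arguments together turn
  -- the unwanted summand into a multiple of the wanted one.
  paths-sucˡ : ∀ a b → suc a * paths (suc a) b ≡ suc (a + b) * paths a b
  paths-sucʳ : ∀ a b → suc b * paths a (suc b) ≡ suc (a + b) * paths a b

  paths-sucˡ a zero rewrite +-identityʳ a with a
  ... | zero  = refl
  ... | suc _ = refl
  paths-sucˡ a (suc b) = begin
    suc a * (paths a (suc b) + paths (suc a) b)
      ≡⟨ *-distribˡ-+ (suc a) (paths a (suc b)) (paths (suc a) b) ⟩
    suc a * paths a (suc b) + suc a * paths (suc a) b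
      ≡⟨ cong (suc a * paths a (suc b) +_) (trans (paths-sucˡ a b) (sym (paths-sucʳ a b))) ⟩
    suc a * paths a (suc b) + suc b * paths a (suc b)
      ≡⟨ *-distribʳ-+ (paths a (suc b)) (suc a) (suc b) ⟨
    suc (a + suc b) * paths a (suc b) ∎
    where open ≡-Reasoning

  paths-sucʳ zero    b = refl
  paths-sucʳ (suc a) b = begin
    suc b * (paths a (suc b) + paths (suc a) b)
      ≡⟨ *-distribˡ-+ (suc b) (paths a (suc b)) (paths (suc a) b) ⟩
    suc b * paths a (suc b) + suc b * paths (suc a) b
      ≡⟨ cong (_+ suc b * paths (suc a) b) (trans (paths-sucʳ a b) (sym (paths-sucˡ a b))) ⟩
    suc a * paths (suc a) b + suc b * paths (suc a) b
      ≡⟨ *-distribʳ-+ (paths (suc a) b) (suc a) (suc b) ⟨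
    (suc a + suc b) * paths (suc a) b
      ≡⟨ cong (_* paths (suc a) b) (cong suc (+-suc a b)) ⟩
    suc (suc a + b) * paths (suc a) b ∎
    where open ≡-Reasoning

  paths-exchange : ∀ a b → suc a * paths (suc a) b ≡ suc b * paths a (suc b)
  paths-exchange a b = trans (paths-sucˡ a b) (sym (paths-sucʳ a b))

  module _ (j : ℕ) where

    term : ℕ → ℕ → ℕ
    term a b = paths a b * j ^ b

    -- The sum of term i (a + b ∸ i) over i ≤ a.
    partialSum : ℕ → ℕ → ℕ
    partialSum zero    b = term zero b
    partialSum (suc a) b = term (suc a) b + partialSum a (suc b)

    -- Pascal's rule in every term: the summand with one left step fewer keeps its power of `j`, the
    -- one with one right step fewer gives up a factor `j`.
    partialSum-suc : ∀ a b →
      partialSum (suc a) (suc b) ≡ partialSum a (suc b) + j * partialSum (suc a) b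
    partialSum-suc zero b = lemma (paths 1 b) (j ^ b) j
      where
      lemma : ∀ p x j → (1 + p) * (j * x) + (1 * (j * (j * x))) ≡ 1 * (j * x) + j * (p * x + 1 * (j * x))
      lemma = solve-∀
    partialSum-suc (suc a) b = begin
      (paths (suc a) (suc b) + paths (suc (suc a)) b) * (j * j ^ b) + partialSum (suc a) (suc (suc b))
        ≡⟨ cong ((paths (suc a) (suc b) + paths (suc (suc a)) b) * (j * j ^ b) +_) (partialSum-suc a (suc b)) ⟩
      (paths (suc a) (suc b) + paths (suc (suc a)) b) * (j * j ^ b)
        + (partialSum a (suc (suc b)) + j * partialSum (suc a) (suc b))
        ≡⟨ lemma (paths (suc a) (suc b)) (paths (suc (suc a)) b) j (j ^ b) (partialSum a (suc (suc b))) (partialSum (suc a) (suc b)) ⟩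
      (paths (suc a) (suc b) * (j * j ^ b) + partialSum a (suc (suc b)))
        + j * (paths (suc (suc a)) b * j ^ b + partialSum (suc a) (suc b)) ∎
      where
      open ≡-Reasoning
      lemma : ∀ p q j x s t → (p + q) * (j * x) + (s + j * t) ≡ (p * (j * x) + s) + j * (q * x + t)
      lemma = solve-∀

    -- The binomial theorem: by `partialSum-suc`, raising the degree by one multiplies the sum by
    -- `1 + j`.
    partialSum≡^ : ∀ n → partialSum n 0 ≡ suc j ^ n
    partialSum≡^ zero          = refl
    partialSum≡^ (suc zero)    = lemma j
      where
      lemma : ∀ j → 1 * 1 + 1 * (j * 1) ≡ 1 * 1 + j * (1 * 1)
      lemma = solve-∀
    partialSum≡^ (suc (suc n)) = begin
      1 + partialSum (suc n) 1
        -- The leading 1 completes `partialSum n 1` to `partialSum (suc n) 0`.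
        ≡⟨ cong (1 +_) (partialSum-suc n 0) ⟩
      partialSum (suc n) 0 + j * partialSum (suc n) 0
        ≡⟨ cong (suc j *_) (partialSum≡^ (suc n)) ⟩
      suc j ^ suc (suc n) ∎
      where open ≡-Reasoning

    private
      -- The quotient of neighbouring terms: comparing `suc b` with `suc a * j` decides whether the
      -- terms rise or fall.
      term-exchange : ∀ a b → suc b * term a (suc b) ≡ (suc a * j) * term (suc a) b
      term-exchange a b = begin
        suc b * (paths a (suc b) * (j * j ^ b))
          ≡⟨ *-assoc (suc b) (paths a (suc b)) (j * j ^ b) ⟨
        suc b * paths a (suc b) * (j * j ^ b)
          ≡⟨ cong (_* (j * j ^ b)) (sym (paths-exchange a b)) ⟩
        suc a * paths (suc a) b * (j * j ^ b)
          ≡⟨ lemma (suc a) (paths (suc a) b) j (j ^ b) ⟩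
        (suc a * j) * (paths (suc a) b * j ^ b) ∎
        where
        open ≡-Reasoning
        lemma : ∀ s p j x → s * p * (j * x) ≡ (s * j) * (p * x)
        lemma = solve-∀

    term-decreasing : ∀ a b → suc b ≤ suc a * j → term (suc a) b ≤ term a (suc b)
    term-decreasing a b h = *-cancelˡ-≤ (suc b) (begin
      suc b * term (suc a) b       ≤⟨ *-monoˡ-≤ (term (suc a) b) h ⟩
      (suc a * j) * term (suc a) b ≡⟨ term-exchange a b ⟨
      suc b * term a (suc b)       ∎)
      where open ≤-Reasoning

    term-increasing : ∀ a b → suc a * j ≤ suc b → term a (suc b) ≤ term (suc a) b
    term-increasing a b h = *-cancelˡ-≤ (suc b) (begin
      suc b * term a (suc b)       ≡⟨ term-exchange a b ⟩
      (suc a * j) * term (suc a) b ≤⟨ *-monoˡ-≤ (term (suc a) b) h ⟩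
      suc b * term (suc a) b       ∎)
      where open ≤-Reasoning

    module _ (L : ℕ) where

      term-max-right : ∀ i b → i + b ≡ j * L → term (i + L) b ≤ term L (j * L)
      term-max-right zero    b e = ≤-reflexive (cong (term L) e)
      term-max-right (suc i) b e = ≤-trans (term-decreasing (i + L) b h)
        (term-max-right i (suc b) (trans (+-suc i b) e))
        where
        open ≤-Reasoning
        h : suc b ≤ suc (i + L) * j
        h = begin
          suc b           ≤⟨ m≤n+m (suc b) i ⟩
          i + suc b       ≡⟨ trans (+-suc i b) e ⟩
          j * L           ≡⟨ *-comm j L ⟩
          L * j           ≤⟨ *-monoˡ-≤ j (≤-trans (m≤n+m L i) (n≤1+n (i + L))) ⟩
          suc (i + L) * j ∎

      term-max-left : ∀ i a → i + a ≡ L → term a (i + j * L) ≤ term L (j * L)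
      term-max-left zero    a e = ≤-reflexive (cong (λ x → term x (j * L)) e)
      term-max-left (suc i) a e = ≤-trans (term-increasing a (i + j * L) h)
        (term-max-left i (suc a) (trans (+-suc i a) e))
        where
        open ≤-Reasoning
        h : suc a * j ≤ suc (i + j * L)
        h = begin
          suc a * j       ≤⟨ *-monoˡ-≤ j (≤-trans (m≤n+m (suc a) i) (≤-reflexive (trans (+-suc i a) e))) ⟩
          L * j           ≡⟨ *-comm L j ⟩
          j * L           ≤⟨ ≤-trans (m≤n+m (j * L) i) (n≤1+n (i + j * L)) ⟩
          suc (i + j * L) ∎

      -- Along `a + b ≡ L + j * L` the quotient of neighbouring terms crosses 1 at `a ≡ L`; each
      -- side is an induction on the distance from there.
      term-max : ∀ a b → a + b ≡ L + j * L → term a b ≤ term L (j * L)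
      term-max a b e with ≤-total L a
      ... | inj₁ L≤a = subst (λ x → term x b ≤ term L (j * L)) (m∸n+n≡m L≤a)
        (term-max-right (a ∸ L) b (+-cancelˡ-≡ L _ _ (begin
          L + (a ∸ L + b) ≡⟨ +-assoc L (a ∸ L) b ⟨
          L + (a ∸ L) + b ≡⟨ cong (_+ b) (m+[n∸m]≡n L≤a) ⟩
          a + b           ≡⟨ e ⟩
          L + j * L       ∎)))
        where
        open ≡-Reasoning
      ... | inj₂ a≤L = subst (λ x → term a x ≤ term L (j * L))
        (+-cancelˡ-≡ a _ _ (begin
          a + (L ∸ a + j * L) ≡⟨ +-assoc a (L ∸ a) (j * L) ⟨
          a + (L ∸ a) + j * L ≡⟨ cong (_+ j * L) (m+[n∸m]≡n a≤L) ⟩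
          L + j * L           ≡⟨ e ⟨
          a + b               ∎))
        (term-max-left (L ∸ a) a (m∸n+n≡m a≤L))
        where open ≡-Reasoning

      partialSum-≤ : ∀ a b → a + b ≡ L + j * L → partialSum a b ≤ suc a * term L (j * L)
      partialSum-≤ zero    b e = ≤-trans (term-max 0 b e) (m≤m+n _ _)
      partialSum-≤ (suc a) b e = +-mono-≤ (term-max (suc a) b e) (partialSum-≤ a (suc b) (trans (+-suc a b) e))

      -- The largest of the suc j * L + 1 terms in the binomial expansion of (1 + j) ^ (suc j * L).
      ^≤paths : suc j ^ (suc j * L) ≤ suc (suc j * L) * (paths L (j * L) * j ^ (j * L))
      ^≤paths = subst (_≤ suc (suc j * L) * term L (j * L)) (partialSum≡^ (suc j * L))
        (partialSum-≤ (suc j * L) 0 (+-identityʳ _))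

  -- Exponential growth from blocks

  module _ (L d : ℕ) where

    -- Counts blocks of `j` colours: the `L` letters of the newest colour are shuffled among the
    -- others and form a weakly increasing word over `d + 1` values.
    blockCount : ℕ → ℕ
    blockCount zero    = 1
    blockCount (suc j) = paths L (j * L) * (paths L d * blockCount j)

    -- The bounds `^≤paths` on the shuffle factors telescope: the denominator at `suc j` is the
    -- power gained at `j`. `C` bounds the number of terms of every expansion used.
    ^≤blockCount : ∀ C j → suc (j * L) ≤ C →
      j ^ (j * L) * paths L d ^ j ≤ C ^ j * blockCount j
    ^≤blockCount C zero    h = ≤-refl
    ^≤blockCount C (suc j) h = begin
      suc j ^ (suc j * L) * (Y * Y ^ j)
        ≤⟨ *-monoˡ-≤ (Y * Y ^ j) (^≤paths j L) ⟩
      suc (suc j * L) * (X * j ^ (j * L)) * (Y * Y ^ j)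
        ≤⟨ *-monoˡ-≤ (Y * Y ^ j) (*-monoˡ-≤ (X * j ^ (j * L)) h) ⟩
      C * (X * j ^ (j * L)) * (Y * Y ^ j)
        ≡⟨ lemma₁ C X Y (j ^ (j * L)) (Y ^ j) ⟩
      C * X * Y * (j ^ (j * L) * Y ^ j)
        ≤⟨ *-monoʳ-≤ (C * X * Y) (^≤blockCount C j (≤-trans (s≤s (m≤n+m (j * L) L)) h)) ⟩
      C * X * Y * (C ^ j * blockCount j)
        ≡⟨ lemma₂ C X Y (C ^ j) (blockCount j) ⟩
      C * C ^ j * (X * (Y * blockCount j)) ∎
      where
      open ≤-Reasoning
      X = paths L (j * L)
      Y = paths L d
      lemma₁ : ∀ c x y p q → c * (x * p) * (y * q) ≡ c * x * y * (p * q)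
      lemma₁ = solve-∀
      lemma₂ : ∀ c x y p q → c * x * y * (p * q) ≡ c * p * (x * (y * q))
      lemma₂ = solve-∀

  ^-distribʳ-* : ∀ o m n → (m * n) ^ o ≡ m ^ o * n ^ o
  ^-distribʳ-* zero    m n = refl
  ^-distribʳ-* (suc o) m n =
    trans (cong (m * n *_) (^-distribʳ-* o m n)) (interchange m n (m ^ o) (n ^ o))
    where
    interchange : ∀ m n x y → m * n * (x * y) ≡ m * x * (n * y)
    interchange = solve-∀

  ^-^-comm : ∀ m n o → (m ^ n) ^ o ≡ (m ^ o) ^ n
  ^-^-comm m n o = trans (^-*-assoc m n o) (trans (cong (m ^_) (*-comm n o)) (sym (^-*-assoc m o n)))

  -- With `d ≡ k * L`, `^≤paths` applies to the value factors too, each with denominator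
  -- `k ^ (k * L)`. One of these `k` denominators cancels against the power gained in
  -- `^≤blockCount`, which leaves `k ^ (k ∸ 1)`.
  blockCount-lower : ∀ k .{{_ : NonZero k}} L →
    (suc k ^ suc k) ^ (k * L) ≤
    (suc (suc k * L) ^ k * suc (suc k * L) ^ k) * blockCount L (k * L) k * (k ^ (k ∸ 1)) ^ (k * L)
  blockCount-lower k@(suc k′) L = *-cancelʳ-≤ _ _ Z {{m^n≢0 k e}} (begin
    (K ^ K) ^ e * Z
      ≡⟨ cong (_* Z) regroup ⟩
    (K ^ (K * L)) ^ k * Z
      ≤⟨ *-monoˡ-≤ Z (^-monoˡ-≤ k (^≤paths k L)) ⟩
    (C * (Y * Z)) ^ k * Z
      ≡⟨ cong (_* Z) (trans (^-distribʳ-* k C (Y * Z)) (cong (C ^ k *_) (^-distribʳ-* k Y Z))) ⟩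
    C ^ k * (Y ^ k * Z ^ k) * Z
      ≡⟨ lemma₁ (C ^ k) (Y ^ k) (Z ^ k) Z ⟩
    C ^ k * Z ^ k * (Z * Y ^ k)
      ≤⟨ *-monoʳ-≤ (C ^ k * Z ^ k) (^≤blockCount L e C k (s≤s (m≤n+m e L))) ⟩
    C ^ k * Z ^ k * (C ^ k * B)
      ≡⟨ cong (λ z → C ^ k * z * (C ^ k * B)) Z^k ⟩
    C ^ k * (Z * (k ^ k′) ^ e) * (C ^ k * B)
      ≡⟨ lemma₂ (C ^ k) Z ((k ^ k′) ^ e) B ⟩
    C ^ k * C ^ k * B * (k ^ k′) ^ e * Z ∎)
    where
    open ≤-Reasoning
    K = suc k
    e = k * L
    C = suc (K * L)
    Y = paths L e
    Z = k ^ e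
    B = blockCount L e k
    regroup : (K ^ K) ^ e ≡ (K ^ (K * L)) ^ k
    regroup = trans (^-*-assoc K K e) (trans (cong (K ^_) (swap K k L)) (sym (^-*-assoc K (K * L) k)))
      where
      swap : ∀ x y z → x * (y * z) ≡ x * z * y
      swap = solve-∀
    Z^k : Z ^ k ≡ Z * (k ^ k′) ^ e
    Z^k = trans (^-^-comm k e k) (^-distribʳ-* e k (k ^ k′))
    lemma₁ : ∀ c y z x → c * (y * z) * x ≡ c * z * (x * y)
    lemma₁ = solve-∀
    lemma₂ : ∀ c z t b → c * (z * t) * (c * b) ≡ c * c * b * t * z
    lemma₂ = solve-∀

  -- Bernoulli's inequality for `1 + 1 / v`, which is at most `u / v`, cleared of denominators.
  bernoulli : ∀ {v u} → v < u → ∀ m → v ^ m * (v + m) ≤ v * u ^ m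
  bernoulli {v} {u} v<u zero    = ≤-reflexive (lemma v)
    where
    lemma : ∀ v → 1 * (v + 0) ≡ v * 1
    lemma = solve-∀
  bernoulli {v} {u} v<u (suc m) = begin
    v * v ^ m * (v + suc m)           ≤⟨ m≤m+n _ (v ^ m * m) ⟩
    v * v ^ m * (v + suc m) + v ^ m * m ≡⟨ lemma₁ v (v ^ m) m ⟩
    suc v * (v ^ m * (v + m))         ≤⟨ *-mono-≤ v<u (bernoulli v<u m) ⟩
    u * (v * u ^ m)                   ≡⟨ lemma₂ u v (u ^ m) ⟩
    v * (u * u ^ m)                   ∎
    where
    open ≤-Reasoning
    lemma₁ : ∀ v x m → v * x * (v + (1 + m)) + x * m ≡ (1 + v) * (x * (v + m))
    lemma₁ = solve-∀
    lemma₂ : ∀ u v x → u * (v * x) ≡ v * (u * x)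
    lemma₂ = solve-∀

  -- The cube of `bernoulli` at exponent `s` gives cubic growth in `s` for `L ≡ s * 3`, against a
  -- quadratic loss.
  ^-dominates-square : ∀ K c v u → .{{_ : NonZero K}} .{{_ : NonZero c}} .{{_ : NonZero v}} → v < u →
    ∃ λ L → c * (suc (K * L) * suc (K * L)) * v ^ L ≤ u ^ L
  ^-dominates-square K c v u v<u = L , *-cancelʳ-≤ _ _ (v ^ 3) {{m^n≢0 v 3}} (begin
    c * (C * C) * v ^ L * v ^ 3
      ≤⟨ *-monoˡ-≤ (v ^ 3) (*-monoˡ-≤ (v ^ L) (*-monoʳ-≤ c (*-mono-≤ C≤ C≤))) ⟩
    c * (4 * K * s * (4 * K * s)) * v ^ L * v ^ 3
      ≡⟨ lemma c K s (v ^ L) (v ^ 3) ⟩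
    v ^ L * (s * (s * s))
      ≤⟨ *-monoʳ-≤ (v ^ L) (≤-trans (≤-reflexive (lemma₃ s)) (^-monoˡ-≤ 3 (m≤n+m s v))) ⟩
    v ^ L * (v + s) ^ 3
      ≡⟨ cong (_* (v + s) ^ 3) (^-*-assoc v s 3) ⟨
    (v ^ s) ^ 3 * (v + s) ^ 3
      ≡⟨ ^-distribʳ-* 3 (v ^ s) (v + s) ⟨
    (v ^ s * (v + s)) ^ 3
      ≤⟨ ^-monoˡ-≤ 3 (bernoulli v<u s) ⟩
    (v * u ^ s) ^ 3
      ≡⟨ trans (^-distribʳ-* 3 v (u ^ s)) (cong (v ^ 3 *_) (^-*-assoc u s 3)) ⟩
    v ^ 3 * u ^ L
      ≡⟨ *-comm (v ^ 3) (u ^ L) ⟩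
    u ^ L * v ^ 3 ∎)
    where
    open ≤-Reasoning
    -- Chosen so that `c * (4 * K * s) ^ 2 * v ^ 3` is exactly `s ^ 3`, where `4 * K * s` bounds
    -- `C`.
    s = 16 * c * (K * K) * v ^ 3
    L = s * 3
    C = suc (K * L)
    instance
      _ = m^n≢0 v 3
      _ = m*n≢0 16 c
      _ = m*n≢0 K K
      _ = m*n≢0 (16 * c) (K * K)
      s≢0 : NonZero s
      s≢0 = m*n≢0 (16 * c * (K * K)) (v ^ 3)
      _ = m*n≢0 K s
    C≤ : C ≤ 4 * K * s
    C≤ = begin
      1 + K * (s * 3)     ≤⟨ +-monoˡ-≤ (K * (s * 3)) (>-nonZero⁻¹ (K * s)) ⟩
      K * s + K * (s * 3) ≡⟨ lemma′ K s ⟩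
      4 * K * s           ∎
      where
      lemma′ : ∀ k s → k * s + k * (s * 3) ≡ 4 * k * s
      lemma′ = solve-∀
    lemma : ∀ c k s x y → c * (4 * k * s * (4 * k * s)) * x * y ≡ x * (16 * c * (k * k) * y * (s * s))
    lemma = solve-∀
    lemma₃ : ∀ s → s * (s * s) ≡ s * (s * (s * 1))
    lemma₃ = solve-∀

  <2^ : ∀ n → n < 2 ^ n
  <2^ zero    = s≤s z≤n
  <2^ (suc n) = begin-strict
    suc n         <⟨ s<s (<2^ n) ⟩
    suc (2 ^ n)   ≤⟨ +-monoˡ-≤ (2 ^ n) (m^n>0 2 n) ⟩
    2 ^ n + 2 ^ n ≡⟨ cong (2 ^ n +_) (+-identityʳ (2 ^ n)) ⟨
    2 ^ suc n     ∎
    where open ≤-Reasoning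

  module _ (k : ℕ) .{{_ : NonZero k}} (a b : ℕ) .{{_ : NonZero a}} where

    private
      R = suc k ^ suc k
      T = k ^ (k ∸ 1)

    -- The factor 2 is the gain per block that pays for the leftover letters in `blocks⇒growth`. The
    -- exponent is the number of new letters that a block takes, one more than its length.
    blockCount-beats : a * T < b * R →
      ∃ λ L → 2 * a ^ suc (k * L) ≤ b ^ suc (k * L) * blockCount L (k * L) k
    blockCount-beats v<u = L , (begin
      2 * (a * a ^ e)   ≡⟨ *-assoc 2 a (a ^ e) ⟨
      2 * a * a ^ e     ≤⟨ *-cancelʳ-≤ _ _ (C ^ k * C ^ k * T ^ e) (begin
        2 * a * a ^ e * (C ^ k * C ^ k * T ^ e)
          ≡⟨ lemma₁ (2 * a) (a ^ e) (C ^ k) (T ^ e) ⟩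
        2 * a * (C ^ k * C ^ k) * (a ^ e * T ^ e)
          -- `2 * a` is enlarged to a `k`-th power, so that what remains is the `k`-th power of
          -- `^-dominates-square`.
          ≤⟨ *-monoˡ-≤ (a ^ e * T ^ e) (*-monoˡ-≤ (C ^ k * C ^ k) c≤c^k) ⟩
        (2 * a) ^ k * (C ^ k * C ^ k) * (a ^ e * T ^ e)
          ≡⟨ cong₂ _*_ (trans (cong ((2 * a) ^ k *_) (sym (^-distribʳ-* k C C))) (sym (^-distribʳ-* k (2 * a) (C * C)))) split-v ⟩
        (2 * a * (C * C)) ^ k * (v ^ L) ^ k
          ≡⟨ ^-distribʳ-* k (2 * a * (C * C)) (v ^ L) ⟨
        (2 * a * (C * C) * v ^ L) ^ k
          ≤⟨ ^-monoˡ-≤ k bound ⟩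
        (u ^ L) ^ k
          ≡⟨ trans (^-^-comm u L k) (^-*-assoc u k L) ⟩
        u ^ e
          ≡⟨ ^-distribʳ-* e b R ⟩
        b ^ e * R ^ e
          ≤⟨ *-monoʳ-≤ (b ^ e) (blockCount-lower k L) ⟩
        b ^ e * (C ^ k * C ^ k * B * T ^ e)
          ≡⟨ lemma₂ (b ^ e) (C ^ k) B (T ^ e) ⟩
        b ^ e * B * (C ^ k * C ^ k * T ^ e) ∎) ⟩
      b ^ e * B         ≤⟨ *-monoˡ-≤ B (m≤n*m (b ^ e) b {{b≢0}}) ⟩
      b * b ^ e * B     ∎)
      where
      open ≤-Reasoning
      u = b * R
      v = a * T
      instance
        _ = m^n≢0 k (k ∸ 1)
        _ = m*n≢0 a T
        _ = m*n≢0 2 a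
      L,bound = ^-dominates-square (suc k) (2 * a) v u v<u
      L = proj₁ L,bound
      bound = proj₂ L,bound
      e = k * L
      C = suc (suc k * L)
      B = blockCount L e k
      b≢0 : NonZero b
      b≢0 = m*n≢0⇒m≢0 b {{>-nonZero (≤-<-trans z≤n v<u)}}
      instance
        _ = m^n≢0 C k
        _ = m*n≢0 (C ^ k) (C ^ k)
        _ = m^n≢0 T e
        _ = m*n≢0 (C ^ k * C ^ k) (T ^ e)
      c≤c^k : 2 * a ≤ (2 * a) ^ k
      c≤c^k = ≤-trans (≤-reflexive (sym (*-identityʳ (2 * a)))) (^-monoʳ-≤ (2 * a) (>-nonZero⁻¹ k))
      split-v : a ^ e * T ^ e ≡ (v ^ L) ^ k
      split-v = trans (sym (^-distribʳ-* e a T)) (trans (sym (^-*-assoc v k L)) (^-^-comm v k L))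
      lemma₁ : ∀ x y c t → x * y * (c * c * t) ≡ x * (c * c) * (y * t)
      lemma₁ = solve-∀
      lemma₂ : ∀ x c y t → x * (c * c * y * t) ≡ x * y * (c * c * t)
      lemma₂ = solve-∀

    -- Fewer than `suc k * D` of the `n` letters are left over by `N` blocks. They cost at most the
    -- constant `A`, which `2 ^ N` exceeds once `N` reaches `A`.
    blocks⇒growth : ∀ (w : ℕ → ℕ) M D .{{_ : NonZero D}} .{{_ : NonZero b}} →
      2 * a ^ D ≤ b ^ D * M →
      (∀ n N → (N + k) * D ≤ n → M ^ N ≤ w n) →
      ∃ λ N₀ → ∀ n → N₀ ≤ n → a ^ n < b ^ n * w n
    blocks⇒growth w M D h blocks = (A + k) * D , bound
      where
      A = a ^ (suc k * D)
      bound : ∀ n → (A + k) * D ≤ n → a ^ n < b ^ n * w n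
      bound n N₀≤n = begin-strict
        a ^ n                   ≡⟨ cong (a ^_) n≡ ⟩
        a ^ (r + k * D + D * N) ≡⟨ ^-distribˡ-+-* a (r + k * D) (D * N) ⟩
        a ^ (r + k * D) * a ^ (D * N)
          ≤⟨ *-monoˡ-≤ (a ^ (D * N)) (^-monoʳ-≤ a (+-monoˡ-≤ (k * D) (<⇒≤ (m%n<n n D)))) ⟩
        A * a ^ (D * N)
          <⟨ *-monoˡ-< (a ^ (D * N)) {{m^n≢0 a (D * N)}} (≤-<-trans A≤N (<2^ N)) ⟩
        2 ^ N * a ^ (D * N)     ≡⟨ cong (2 ^ N *_) (^-*-assoc a D N) ⟨
        2 ^ N * (a ^ D) ^ N     ≡⟨ ^-distribʳ-* N 2 (a ^ D) ⟨
        (2 * a ^ D) ^ N         ≤⟨ ^-monoˡ-≤ N h ⟩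
        (b ^ D * M) ^ N         ≡⟨ ^-distribʳ-* N (b ^ D) M ⟩
        (b ^ D) ^ N * M ^ N     ≡⟨ cong (_* M ^ N) (^-*-assoc b D N) ⟩
        b ^ (D * N) * M ^ N     ≤⟨ *-mono-≤ (^-monoʳ-≤ b DN≤n) (blocks n N N+k≤) ⟩
        b ^ n * w n             ∎
        where
        open ≤-Reasoning
        Q = n / D
        r = n % D
        N = Q ∸ k
        A+k≤Q : A + k ≤ Q
        A+k≤Q = ≤-trans (≤-reflexive (sym (m*n/n≡m (A + k) D))) (/-monoˡ-≤ D N₀≤n)
        k≤Q : k ≤ Q
        k≤Q = ≤-trans (m≤n+m k A) A+k≤Q
        A≤N : A ≤ N
        A≤N = ≤-trans (≤-reflexive (sym (m+n∸n≡m A k))) (∸-monoˡ-≤ k A+k≤Q)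
        lemma : ∀ r k D N → r + (N + k) * D ≡ r + k * D + D * N
        lemma = solve-∀
        n≡ : n ≡ r + k * D + D * N
        n≡ = trans (m≡m%n+[m/n]*n n D)
          (trans (cong (λ q → r + q * D) (sym (m∸n+n≡m k≤Q))) (lemma r k D N))
        DN≤n : D * N ≤ n
        DN≤n = ≤-trans (m≤n+m (D * N) (r + k * D)) (≤-reflexive (sym n≡))
        N+k≤ : (N + k) * D ≤ n
        N+k≤ = ≤-trans (m≤n+m ((N + k) * D) r) (≤-reflexive (trans (lemma r k D N) (sym n≡)))

  private
    variable
      X Y : Set
      a b k n : ℕ

  -- Upper bound: sorting avoiders into k piles

  Unique-lookup-injective : ∀ {xs : List X} → Unique xs → Injective _≡_ _≡_ (List.lookup xs)
  Unique-lookup-injective (x∉xs ∷ _) {Fin.zero}  {Fin.zero}  e = refl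
  Unique-lookup-injective (x∉xs ∷ _) {Fin.zero}  {Fin.suc j} e = contradiction e (Listₐ.lookup x∉xs (∈-lookup j))
  Unique-lookup-injective (x∉xs ∷ _) {Fin.suc i} {Fin.zero}  e = contradiction (sym e) (Listₐ.lookup x∉xs (∈-lookup i))
  Unique-lookup-injective (_ ∷ xs!)  {Fin.suc i} {Fin.suc j} e = cong Fin.suc (Unique-lookup-injective xs! e)

  -- `f` induces an injection from the positions of `xs` into those of `ys`.
  length-≤ : ∀ {xs : List X} {ys : List Y} (f : X → Y) → Unique xs → Injective _≡_ _≡_ f →
    (∀ {x} → x ∈ xs → f x ∈ ys) → length xs ≤ length ys
  length-≤ {xs = xs} {ys} f xs! f-injective f∈ = Finₚ.injective⇒≤ {f = g} g-injective
    where
    f[_]∈ : ∀ i → f (List.lookup xs i) ∈ ys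
    f[ i ]∈ = f∈ (∈-lookup i)
    g : Fin (length xs) → Fin (length ys)
    g i = Any.index f[ i ]∈
    g-injective : Injective _≡_ _≡_ g
    g-injective {i} {j} e = Unique-lookup-injective xs! (f-injective
      (trans (lookup-index f[ i ]∈) (trans (cong (List.lookup ys) e) (sym (lookup-index f[ j ]∈)))))

  finToFun-injective : ∀ {m n} {c d : Fin (m ^ n)} → (∀ i → finToFun {m} {n} c i ≡ finToFun d i) → c ≡ d
  finToFun-injective {m} {n} {c} {d} e = begin
    c                            ≡⟨ Finₚ.funToFin-finToFin {n} {m} c ⟨
    funToFin (finToFun {m} {n} c) ≡⟨ funToFin-cong n e ⟩
    funToFin (finToFun {m} {n} d) ≡⟨ Finₚ.funToFin-finToFin {n} {m} d ⟩
    d                            ∎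
    where
    open ≡-Reasoning
    funToFin-cong : ∀ n {f g : Fin n → Fin m} → (∀ i → f i ≡ g i) → funToFin f ≡ funToFin g
    funToFin-cong zero    e = refl
    funToFin-cong (suc n) e = cong₂ Fin.combine (e Fin.zero) (funToFin-cong n (e ∘ Fin.suc))

  -- v has a strictly increasing subsequence of length l with all letters at least b.
  Increasing : ∀ {n} → ℕ → ℕ → Vec ℕ n → Set
  Increasing zero    b v       = ⊤
  Increasing (suc l) b []      = ⊥
  Increasing (suc l) b (x ∷ v) = Increasing (suc l) b v ⊎ b ≤ x × Increasing l (suc x) v

  Increasing⇒positions : ∀ {n} l b (v : Vec ℕ n) → Increasing l b v →
    ∃ λ (i : Fin l → Fin n) → Monotonic₁ Fin._<_ Fin._<_ i ×
      Monotonic₁ Fin._<_ _<_ (Vec.lookup v ∘ i) × (∀ p → b ≤ Vec.lookup v (i p))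
  Increasing⇒positions zero    b v       _ =
    (λ ()) , (λ { {()} }) , (λ { {()} }) , λ ()
  Increasing⇒positions (suc l) b (x ∷ v) (inj₁ h) =
    let i , mono , incr , b≤ = Increasing⇒positions (suc l) b v h in
    Fin.suc ∘ i , (λ p<q → s<s (mono p<q)) , incr , b≤
  Increasing⇒positions (suc l) b (x ∷ v) (inj₂ (b≤x , h)) =
    let i , mono , incr , x< = Increasing⇒positions l (suc x) v h in
    cons i , cons-mono i mono , cons-incr i incr x< ,
    λ { Fin.zero → b≤x ; (Fin.suc p) → ≤-trans b≤x (<⇒≤ (x< p)) }
    where
    cons : ∀ {n} → (Fin l → Fin n) → Fin (suc l) → Fin (suc n)
    cons i Fin.zero    = Fin.zero
    cons i (Fin.suc p) = Fin.suc (i p)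
    cons-mono : ∀ {n} (i : Fin l → Fin n) → Monotonic₁ Fin._<_ Fin._<_ i → Monotonic₁ Fin._<_ Fin._<_ (cons i)
    cons-mono i mono {Fin.zero}  {Fin.suc q} p<q       = s≤s z≤n
    cons-mono i mono {Fin.suc p} {Fin.suc q} (s≤s p<q) = s<s (mono p<q)
    cons-incr : ∀ i → Monotonic₁ Fin._<_ _<_ (Vec.lookup v ∘ i) → (∀ p → suc x ≤ Vec.lookup v (i p)) →
      Monotonic₁ Fin._<_ _<_ (Vec.lookup (x ∷ v) ∘ cons i)
    cons-incr i incr x< {Fin.zero}  {Fin.suc q} p<q       = x< q
    cons-incr i incr x< {Fin.suc p} {Fin.suc q} (s≤s p<q) = incr p<q

  -- With the opposite letters, the state of a pile is the number of letters it still accepts.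
  oppositeWord : ∀ {m n} → Word m n → Vec ℕ n
  oppositeWord w = tabulate (toℕ ∘ opposite ∘ w)

  opposite-cancel-< : ∀ {m} (i j : Fin m) → opposite i Fin.< opposite j → j Fin.< i
  opposite-cancel-< {m} i j h = s<s⁻¹ (∸-cancelˡ-< {m = m} (subst₂ _<_ (Finₚ.opposite-prop i) (Finₚ.opposite-prop j) h))
    where
    ∸-cancelˡ-< : ∀ {m n o} → m ∸ n < m ∸ o → o < n
    ∸-cancelˡ-< {m} {n} {o} h = ≰⇒> λ n≤o → <⇒≱ h (∸-monoʳ-≤ m n≤o)

  Increasing⇒HasDecreasing : ∀ {m n} l (w : Word m n) → Increasing l 0 (oppositeWord w) → HasDecreasing l w
  Increasing⇒HasDecreasing l w h =
    let i , mono , incr , _ = Increasing⇒positions l 0 (oppositeWord w) h in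
    i , mono , λ {p} {q} p<q → opposite-cancel-< (w (i p)) (w (i q))
      (subst₂ _<_ (Vecₚ.lookup∘tabulate _ (i p)) (Vecₚ.lookup∘tabulate _ (i q)) (incr p<q))

  oppositeWord-injective : ∀ {m n} (w w′ : Word m n) → oppositeWord w ≡ oppositeWord w′ → ∀ i → w i ≡ w′ i
  oppositeWord-injective w w′ e i = begin
    w i                       ≡⟨ Finₚ.opposite-involutive (w i) ⟨
    opposite (opposite (w i)) ≡⟨ cong opposite (Finₚ.toℕ-injective eᵢ) ⟩
    opposite (opposite (w′ i)) ≡⟨ Finₚ.opposite-involutive (w′ i) ⟩
    w′ i                      ∎
    where
    open ≡-Reasoning
    eᵢ : toℕ (opposite (w i)) ≡ toℕ (opposite (w′ i))
    eᵢ = trans (sym (Vecₚ.lookup∘tabulate _ i)) (trans (cong (λ v → Vec.lookup v i) e) (Vecₚ.lookup∘tabulate _ i))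

  -- A pile with top t accepts the letters y < t, and its top becomes suc y, so that piles of
  -- opposite letters are weakly decreasing.

  moves : ∀ {k} → Vec ℕ k → List (ℕ × Vec ℕ k)
  moves []       = []
  moves (t ∷ ts) = map (λ y → y , suc y ∷ ts) (downFrom t) ++ map (λ (y , ts′) → y , t ∷ ts′) (moves ts)

  -- A word is listed once for every admissible way of placing its letters, not only the greedy one;
  -- such repetitions are harmless for an upper bound.
  words : ∀ {k} n → Vec ℕ k → List (Vec ℕ n)
  words zero    t = [] ∷ []
  words (suc n) t = concatMap (λ (y , t′) → map (y ∷_) (words n t′)) (moves t)

  -- The top of the j-th pile (or b, for j = 0) starts an increasing subsequence that is too long
  -- to be continued by the remaining piles.
  Overflow : ∀ {k n} → ℕ → Vec ℕ k → Vec ℕ n → Set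
  Overflow {zero}  b []       v = Increasing 1 b v
  Overflow {suc k} b (t ∷ ts) v = Increasing (suc (suc k)) b v ⊎ Overflow t ts v

  Overflow-skip : ∀ {k n} b (t : Vec ℕ k) x (v : Vec ℕ n) → Overflow b t v → Overflow b t (x ∷ v)
  Overflow-skip b []       x v h        = inj₁ h
  Overflow-skip b (t ∷ ts) x v (inj₁ h) = inj₁ (inj₁ h)
  Overflow-skip b (t ∷ ts) x v (inj₂ h) = inj₂ (Overflow-skip t ts x v h)

  -- An overflow at the new top `suc x` becomes, with `x` put in front, an overflow at `b`; one at a
  -- later top is not affected.
  Overflow-replace : ∀ {k n} b c (ts : Vec ℕ k) x (v : Vec ℕ n) → b ≤ x →
    Overflow (suc x) ts v → Overflow b (c ∷ ts) (x ∷ v)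
  Overflow-replace b c []        x v b≤x h        = inj₁ (inj₂ (b≤x , h))
  Overflow-replace b c (_ ∷ ts)  x v b≤x (inj₁ h) = inj₁ (inj₂ (b≤x , h))
  Overflow-replace b c (t₁ ∷ ts) x v b≤x (inj₂ h) = inj₂ (inj₂ (Overflow-skip t₁ ts x v h))

  -- Greedy placement on the first pile that accepts `x`. Here `b` is the top of the preceding pile,
  -- which rejected `x`, so `b ≤ x` lets `x` start a chain at `b`. If no pile accepts, `x` alone
  -- overflows the last one.
  place : ∀ {k} b (t : Vec ℕ k) x → b ≤ x →
    (∃ λ t′ → (x , t′) ∈ moves t × (∀ {n} (v : Vec ℕ n) → Overflow b t′ v → Overflow b t (x ∷ v)))
    ⊎ (∀ {n} (v : Vec ℕ n) → Overflow b t (x ∷ v))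
  place b []       x b≤x = inj₂ (λ v → inj₂ (b≤x , tt))
  place b (t ∷ ts) x b≤x with x <? t
  ... | yes x<t = inj₁ (suc x ∷ ts , ∈-++⁺ˡ (∈-map⁺ _ (∈-downFrom⁺ x<t)) ,
    λ { v (inj₁ h) → inj₁ (inj₁ h) ; v (inj₂ h) → Overflow-replace b t ts x v b≤x h })
  ... | no  x≮t with place t ts x (≮⇒≥ x≮t)
  ...   | inj₁ (ts′ , moved , back) = inj₁ (t ∷ ts′ , ∈-++⁺ʳ _ (∈-map⁺ _ moved) ,
    λ { v (inj₁ h) → inj₁ (inj₁ h) ; v (inj₂ h) → inj₂ (back v h) })
  ...   | inj₂ over = inj₂ (inj₂ ∘ over)

  sorted-or-overflow : ∀ {k n} (t : Vec ℕ k) (v : Vec ℕ n) → v ∈ words n t ⊎ Overflow 0 t v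
  sorted-or-overflow t []      = inj₁ (here refl)
  sorted-or-overflow t (x ∷ v) with place 0 t x z≤n
  ... | inj₂ over = inj₂ (over v)
  ... | inj₁ (t′ , moved , back) with sorted-or-overflow t′ v
  ...   | inj₂ over = inj₂ (back v over)
  ...   | inj₁ v∈   = inj₁ (∈-concatMap⁺ (λ (y , t′) → map (y ∷_) (words _ t′))
    (Any.map (λ { refl → ∈-map⁺ (x ∷_) v∈ }) moved))

  -- The initial tops `m` lie above all letters, so no chain can start from them and only the one
  -- from 0 remains.
  Overflow⇒Increasing : ∀ {k n} m (v : Vec ℕ n) → (∀ i → Vec.lookup v i < m) →
    Overflow 0 (Vec.replicate k m) v → Increasing (suc k) 0 v
  Overflow⇒Increasing {zero}  m v v< h        = h
  Overflow⇒Increasing {suc k} m v v< (inj₁ h) = h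
  Overflow⇒Increasing {suc k} m v v< (inj₂ h) = ⊥-elim (no-overflow {k} v v< h)
    where
    no-increasing : ∀ {l n} (v : Vec ℕ n) → (∀ i → Vec.lookup v i < m) → ¬ Increasing (suc l) m v
    no-increasing (x ∷ v) v< (inj₁ h)       = no-increasing v (v< ∘ Fin.suc) h
    no-increasing (x ∷ v) v< (inj₂ (m≤x , _)) = <⇒≱ (v< Fin.zero) m≤x
    no-overflow : ∀ {k n} (v : Vec ℕ n) → (∀ i → Vec.lookup v i < m) → ¬ Overflow m (Vec.replicate k m) v
    no-overflow {zero}  v v< h        = no-increasing v v< h
    no-overflow {suc k} v v< (inj₁ h) = no-increasing v v< h
    no-overflow {suc k} v v< (inj₂ h) = no-overflow {k} v v< h

  avoiders-≤-words : ∀ n k → wordCount n k ≤ length (words n (Vec.replicate k n))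
  avoiders-≤-words n k = length-≤ (oppositeWord ∘ finToFun {n} {n})
    (Unique.filter⁺ avoids? (Unique.allFin⁺ (n ^ n)))
    (λ {c} {d} e → finToFun-injective {n} {n} (oppositeWord-injective (finToFun {n} {n} c) (finToFun {n} {n} d) e))
    sorted
    where
    avoids? = λ c → ¬? (hasDecreasing? (suc k) (finToFun {n} {n} c))
    sorted : ∀ {c} → c ∈ filter avoids? (allFin (n ^ n)) →
      oppositeWord (finToFun {n} {n} c) ∈ words n (Vec.replicate k n)
    sorted {c} c∈ with sorted-or-overflow (Vec.replicate k n) (oppositeWord (finToFun {n} {n} c))
    ... | inj₁ h = h
    ... | inj₂ h = contradiction
      (Increasing⇒HasDecreasing (suc k) w (Overflow⇒Increasing {k} n (oppositeWord w)
        (λ i → subst (_< n) (sym (Vecₚ.lookup∘tabulate _ i)) (Finₚ.toℕ<n (opposite (w i)))) h))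
      (proj₂ (∈-filter⁻ avoids? {xs = allFin (n ^ n)} c∈))
      where w = finToFun {n} {n} c

  -- The weighted count of sortable words.

  length-concatMap : ∀ (f : X → List Y) xs → length (concatMap f xs) ≡ sum (map (length ∘ f) xs)
  length-concatMap f []       = refl
  length-concatMap f (x ∷ xs) = trans (length-++ (f x)) (cong (length (f x) +_) (length-concatMap f xs))

  module _ (k : ℕ) where

    private K = suc k

    -- A geometric series of ratio `K / k`, whose sum is at most `K` times its last weight.
    -- Denominators are cleared, and the induction closes because `1 + k` is `K`.
    geometric : ∀ e c (f : ℕ → ℕ) → (∀ y → f y * k ^ (suc y + e) ≤ c * K ^ (suc y + e)) → ∀ t →
      sum (map f (downFrom t)) * k ^ (t + e) ≤ c * K ^ suc (t + e)
    geometric e c f h zero    = z≤n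
    geometric e c f h (suc t) = begin
      (f t + S) * (k * k ^ (t + e))
        ≡⟨ lemma₁ (f t) S k (k ^ (t + e)) ⟩
      f t * (k * k ^ (t + e)) + k * (S * k ^ (t + e))
        ≤⟨ +-mono-≤ (h t) (*-monoʳ-≤ k (geometric e c f h t)) ⟩
      c * (K * K ^ (t + e)) + k * (c * (K * K ^ (t + e)))
        ≡⟨ lemma₂ c k (K * K ^ (t + e)) ⟩
      c * (K * (K * K ^ (t + e))) ∎
      where
      open ≤-Reasoning
      S = sum (map f (downFrom t))
      lemma₁ : ∀ a s k x → (a + s) * (k * x) ≡ a * (k * x) + k * (s * x)
      lemma₁ = solve-∀
      lemma₂ : ∀ c k x → c * x + k * (c * x) ≡ c * ((1 + k) * x)
      lemma₂ = solve-∀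

    -- Up to the factor c, (1 + 1/k) ^ (sum of the tops) is a supersolution of the recursion for
    -- the number of words that can be sorted; e stands for the piles that are not moved.
    moves-≤ : ∀ {ℓ} e c (f : Vec ℕ ℓ → ℕ) →
      (∀ t → f t * k ^ (Vec.sum t + e) ≤ c * K ^ (Vec.sum t + e)) → ∀ t →
      sum (map (f ∘ proj₂) (moves t)) * k ^ (Vec.sum t + e) ≤ ℓ * (c * K ^ suc (Vec.sum t + e))
    moves-≤ e c f h [] = z≤n
    moves-≤ {suc ℓ} e c f h (t ∷ ts) = begin
      sum (map (f ∘ proj₂) (moves (t ∷ ts))) * k ^ (t + s + e)
        ≡⟨ cong (_* k ^ (t + s + e)) split ⟩
      (S₁ + S₂) * k ^ (t + s + e)
        ≡⟨ *-distribʳ-+ (k ^ (t + s + e)) S₁ S₂ ⟩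
      S₁ * k ^ (t + s + e) + S₂ * k ^ (t + s + e)
        ≤⟨ +-mono-≤ first others ⟩
      c * K ^ suc (t + s + e) + ℓ * (c * K ^ suc (t + s + e)) ∎
      where
      open ≤-Reasoning
      s = Vec.sum ts
      S₁ = sum (map (λ y → f (suc y ∷ ts)) (downFrom t))
      S₂ = sum (map ((λ ts′ → f (t ∷ ts′)) ∘ proj₂) (moves ts))
      split : sum (map (f ∘ proj₂) (moves (t ∷ ts))) ≡ S₁ + S₂
      split = trans (cong sum (map-++ (f ∘ proj₂) (map _ (downFrom t)) (map _ (moves ts))))
        (trans (sum-++ (map (f ∘ proj₂) (map _ (downFrom t))) _)
          (cong₂ _+_ (cong sum (sym (map-∘ (downFrom t)))) (cong sum (sym (map-∘ (moves ts))))))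
      first : S₁ * k ^ (t + s + e) ≤ c * K ^ suc (t + s + e)
      first = subst (λ x → S₁ * k ^ x ≤ c * K ^ suc x) (sym (+-assoc t s e))
        (geometric (s + e) c (λ y → f (suc y ∷ ts))
          (λ y → subst (λ x → f (suc y ∷ ts) * k ^ suc x ≤ c * K ^ suc x) (+-assoc y s e) (h (suc y ∷ ts))) t)
      shift : ∀ s → t + s + e ≡ s + (t + e)
      shift s = trans (cong (_+ e) (+-comm t s)) (+-assoc s t e)
      others : S₂ * k ^ (t + s + e) ≤ ℓ * (c * K ^ suc (t + s + e))
      others = subst (λ x → S₂ * k ^ x ≤ ℓ * (c * K ^ suc x)) (sym (shift s))
        (moves-≤ (t + e) c (λ ts′ → f (t ∷ ts′))
          (λ ts′ → subst (λ x → f (t ∷ ts′) * k ^ x ≤ c * K ^ x) (shift (Vec.sum ts′)) (h (t ∷ ts′))) ts)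

    -- Each letter costs the factor `k * K`: there are `k` piles, and by `moves-≤` each contributes
    -- at most `K` times the weight.
    words-≤ : ∀ n (t : Vec ℕ k) →
      length (words n t) * k ^ Vec.sum t ≤ (k * K) ^ n * K ^ Vec.sum t
    words-≤ zero    t = *-monoʳ-≤ 1 (^-monoˡ-≤ (Vec.sum t) (n≤1+n k))
    words-≤ (suc n) t = begin
      length (words (suc n) t) * k ^ s
        ≡⟨ cong (_* k ^ s) count ⟩
      sum (map ((length ∘ words n) ∘ proj₂) (moves t)) * k ^ s
        ≡⟨ cong (λ x → sum (map ((length ∘ words n) ∘ proj₂) (moves t)) * k ^ x) (sym (+-identityʳ s)) ⟩
      sum (map ((length ∘ words n) ∘ proj₂) (moves t)) * k ^ (s + 0)
        ≤⟨ moves-≤ 0 ((k * K) ^ n) (length ∘ words n) (λ t → subst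
             (λ x → length (words n t) * k ^ x ≤ (k * K) ^ n * K ^ x) (sym (+-identityʳ (Vec.sum t))) (words-≤ n t)) t ⟩
      k * ((k * K) ^ n * K ^ suc (s + 0))
        ≡⟨ cong (λ x → k * ((k * K) ^ n * K ^ suc x)) (+-identityʳ s) ⟩
      k * ((k * K) ^ n * (K * K ^ s))
        ≡⟨ lemma k K ((k * K) ^ n) (K ^ s) ⟩
      k * K * (k * K) ^ n * K ^ s ∎
      where
      open ≤-Reasoning
      s = Vec.sum t
      count : length (words (suc n) t) ≡ sum (map ((length ∘ words n) ∘ proj₂) (moves t))
      count = trans (length-concatMap _ (moves t))
        (cong sum (map-cong (λ (y , t′) → length-map (y ∷_) (words n t′)) (moves t)))
      lemma : ∀ k K x y → k * (x * (K * y)) ≡ k * K * x * y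
      lemma = solve-∀

  sum-replicate : ∀ k n → Vec.sum (Vec.replicate k n) ≡ k * n
  sum-replicate zero    n = refl
  sum-replicate (suc k) n = cong (n +_) (sum-replicate k n)

  -- All `k` tops start at `n`, so the initial weight is the `n`-th power of `(K / k) ^ k`; its base
  -- times `k * K` is `K ^ K / k ^ (k ∸ 1)`.
  wordCount-upper : ∀ k .{{_ : NonZero k}} n → wordCount n k * (k ^ (k ∸ 1)) ^ n ≤ (suc k ^ suc k) ^ n
  wordCount-upper k@(suc k′) n = *-cancelʳ-≤ _ _ (k ^ n) {{m^n≢0 k n}} (begin
    w * (k ^ k′) ^ n * k ^ n
      ≡⟨ *-assoc w ((k ^ k′) ^ n) (k ^ n) ⟩
    w * ((k ^ k′) ^ n * k ^ n)
      ≡⟨ cong (w *_) (trans (*-comm ((k ^ k′) ^ n) (k ^ n)) (trans (sym (^-distribʳ-* n k (k ^ k′))) (^-*-assoc k k n))) ⟩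
    w * k ^ (k * n)
      ≤⟨ *-monoˡ-≤ (k ^ (k * n)) (avoiders-≤-words n k) ⟩
    length (words n (Vec.replicate k n)) * k ^ (k * n)
      ≤⟨ subst (λ x → length (words n (Vec.replicate k n)) * k ^ x ≤ (k * K) ^ n * K ^ x)
           (sum-replicate k n) (words-≤ k n (Vec.replicate k n)) ⟩
    (k * K) ^ n * K ^ (k * n)
      ≡⟨ cong₂ _*_ (^-distribʳ-* n k K) (sym (^-*-assoc K k n)) ⟩
    k ^ n * K ^ n * (K ^ k) ^ n
      ≡⟨ lemma (k ^ n) (K ^ n) ((K ^ k) ^ n) ⟩
    K ^ n * (K ^ k) ^ n * k ^ n
      ≡⟨ cong (_* k ^ n) (^-distribʳ-* n K (K ^ k)) ⟨
    (K ^ K) ^ n * k ^ n ∎)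
    where
    open ≤-Reasoning
    K = suc k
    w = wordCount n k
    lemma : ∀ x y z → x * y * z ≡ y * z * x
    lemma = solve-∀

  -- Lower bound: words made of shuffled blocks

  map-injective : ∀ {f : X → Y} → Injective _≡_ _≡_ f → Injective _≡_ _≡_ (Vec.map {n = n} f)
  map-injective f-injective {[]}     {[]}     e = refl
  map-injective f-injective {x ∷ xs} {y ∷ ys} e =
    cong₂ _∷_ (f-injective (Vecₚ.∷-injectiveˡ e)) (map-injective f-injective (Vecₚ.∷-injectiveʳ e))

  -- Lattice paths. The length is an index of its own, so that `merge` needs no transport along
  -- sums.
  data Shuffle : ℕ → ℕ → ℕ → Set where
    []     : Shuffle 0 0 0
    left∷  : Shuffle a b n → Shuffle (suc a) b (suc n)
    right∷ : Shuffle a b n → Shuffle a (suc b) (suc n)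

  left∷-injective : {s t : Shuffle a b n} → left∷ s ≡ left∷ t → s ≡ t
  left∷-injective refl = refl

  right∷-injective : {s t : Shuffle a b n} → right∷ s ≡ right∷ t → s ≡ t
  right∷-injective refl = refl

  splitAt-injective : ∀ m {n} → Injective _≡_ _≡_ (splitAt m {n})
  splitAt-injective m {n} {i} {j} e =
    trans (sym (Finₚ.join-splitAt m n i)) (trans (cong (Fin.join m n) e) (Finₚ.join-splitAt m n j))

  remQuot-injective : ∀ {m} n → Injective _≡_ _≡_ (remQuot {m} n)
  remQuot-injective {m} n {i} {j} e =
    trans (sym (Finₚ.combine-remQuot {m} n i))
      (trans (cong (λ (x , y) → combine x y) e) (Finₚ.combine-remQuot {m} n j))

  -- Pascal's rule as a decoding: `splitAt` tells whether the first step goes left or right.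
  shuffle : ∀ a b n → a + b ≡ n → Fin (paths a b) → Shuffle a b n
  shuffle zero    zero    zero    e i = []
  shuffle zero    (suc b) (suc n) e i = right∷ (shuffle zero b n (suc-injective e) i)
  shuffle (suc a) zero    (suc n) e i = left∷ (shuffle a zero n (suc-injective e) (subst Fin (1≡paths a) i))
    where
    1≡paths : ∀ a → 1 ≡ paths a 0
    1≡paths zero    = refl
    1≡paths (suc a) = refl
  shuffle (suc a) (suc b) (suc n) e i =
    [ left∷ ∘ shuffle a (suc b) n (suc-injective e)
    , right∷ ∘ shuffle (suc a) b n (trans (sym (+-suc a b)) (suc-injective e))
    ]′ (splitAt (paths a (suc b)) i)

  shuffle-injective : ∀ a b n e → Injective _≡_ _≡_ (shuffle a b n e)
  shuffle-injective zero    b       n       e {Fin.zero} {Fin.zero} _ = refl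
  shuffle-injective (suc a) zero    (suc n) e {Fin.zero} {Fin.zero} _ = refl
  shuffle-injective (suc a) (suc b) (suc n) e {i} {j} eq =
    splitAt-injective (paths a (suc b)) (cases (splitAt (paths a (suc b)) i) (splitAt (paths a (suc b)) j) eq)
    where
    f : Fin (paths a (suc b)) ⊎ Fin (paths (suc a) b) → Shuffle (suc a) (suc b) (suc n)
    f = [ left∷ ∘ shuffle a (suc b) n (suc-injective e)
        , right∷ ∘ shuffle (suc a) b n (trans (sym (+-suc a b)) (suc-injective e)) ]′
    cases : ∀ x y → f x ≡ f y → x ≡ y
    cases (inj₁ x) (inj₁ y) eq = cong inj₁ (shuffle-injective a (suc b) n _ (left∷-injective eq))
    cases (inj₂ x) (inj₂ y) eq = cong inj₂ (shuffle-injective (suc a) b n _ (right∷-injective eq))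

  -- A lattice path as the weakly increasing word of the heights of its left steps.
  heights : Shuffle a b n → Vec (Fin (suc b)) a
  heights []         = []
  heights (left∷ s)  = Fin.zero ∷ heights s
  heights (right∷ s) = Vec.map Fin.suc (heights s)

  -- As long as a left step remains, the first height is zero precisely when the path begins with a
  -- left step.
  heights-injective : Injective _≡_ _≡_ (heights {a} {b} {n})
  heights-injective {x = []}       {y = []}       e = refl
  heights-injective {x = left∷ s}  {y = left∷ t}  e = cong left∷ (heights-injective (Vecₚ.∷-injectiveʳ e))
  heights-injective {x = left∷ s}  {y = right∷ t} e with heights t
  heights-injective {x = left∷ s}  {y = right∷ t} () | _ ∷ _
  heights-injective {x = right∷ s} {y = left∷ t}  e with heights s
  heights-injective {x = right∷ s} {y = left∷ t}  () | _ ∷ _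
  heights-injective {x = right∷ s} {y = right∷ t} e =
    cong right∷ (heights-injective (map-injective Finₚ.suc-injective e))

  heights-increasing : (s : Shuffle a b n) → AllPairs Fin._≤_ (heights s)
  heights-increasing []         = []
  heights-increasing (left∷ s)  = All.universal (λ _ → z≤n) (heights s) ∷ heights-increasing s
  heights-increasing (right∷ s) = AllPairsₚ.map⁺ (AllPairs.map s≤s (heights-increasing s))

  -- Coloured words and their merging into blocks.

  Sorted : ∀ {X : Set} → Rel X 0ℓ → Vec (Fin k × X) n → Set
  Sorted _≼_ = AllPairs (λ (c , x) (d , y) → c ≡ d → x ≼ y)

  merge : Shuffle a b n → Vec X a → Vec (Fin k × X) b → Vec (Fin (suc k) × X) n
  merge []         []       []             = []
  merge (left∷ s)  (x ∷ xs) ys             = (Fin.zero , x) ∷ merge s xs ys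
  merge (right∷ s) xs       ((c , y) ∷ ys) = (Fin.suc c , y) ∷ merge s xs ys

  -- The colour of each letter, zero or a successor, reveals which step the shuffle took there.
  merge-injective : ∀ (s s′ : Shuffle a b n) {xs xs′ : Vec X a} {ys ys′ : Vec (Fin k × X) b} →
    merge s xs ys ≡ merge s′ xs′ ys′ → s ≡ s′ × xs ≡ xs′ × ys ≡ ys′
  merge-injective [] [] {[]} {[]} {[]} {[]} e = refl , refl , refl
  merge-injective (left∷ s) (left∷ s′) {x ∷ xs} {x′ ∷ xs′} e
    with refl ← Vecₚ.∷-injectiveˡ e
    with refl , refl , refl ← merge-injective s s′ {xs} {xs′} (Vecₚ.∷-injectiveʳ e) = refl , refl , refl
  merge-injective (left∷ s) (right∷ s′) {x ∷ xs} {_} {_} {y′ ∷ ys′} ()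
  merge-injective (right∷ s) (left∷ s′) {_} {x ∷ xs} {y ∷ ys} ()
  merge-injective (right∷ s) (right∷ s′) {ys = y ∷ ys} {y′ ∷ ys′} e
    with refl ← Vecₚ.∷-injectiveˡ e
    with refl , refl , refl ← merge-injective s s′ {ys = ys} {ys′} (Vecₚ.∷-injectiveʳ e) = refl , refl , refl

  All-merge : ∀ {P : Fin (suc k) × X → Set} (s : Shuffle a b n) {xs : Vec X a} {ys : Vec (Fin k × X) b} →
    All (λ x → P (Fin.zero , x)) xs → All (λ (c , y) → P (Fin.suc c , y)) ys → All P (merge s xs ys)
  All-merge []         []         []         = []
  All-merge (left∷ s)  (px ∷ pxs) pys        = px ∷ All-merge s pxs pys
  All-merge (right∷ s) pxs        (py ∷ pys) = py ∷ All-merge s pxs pys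

  Sorted-merge : ∀ {_≼_ : Rel X 0ℓ} (s : Shuffle a b n) {xs : Vec X a} {ys : Vec (Fin k × X) b} →
    AllPairs _≼_ xs → Sorted _≼_ ys → Sorted _≼_ (merge s xs ys)
  Sorted-merge [] [] [] = []
  Sorted-merge (left∷ s) {ys = ys} (x≼ ∷ xs≼) ys≼ =
    All-merge s (All.map (λ x≼y _ → x≼y) x≼) (All.universal (λ _ ()) ys) ∷ Sorted-merge s xs≼ ys≼
  Sorted-merge (right∷ s) {xs = xs} xs≼ (y≼ ∷ ys≼) =
    All-merge s (All.universal (λ _ ()) xs) (All.map (λ r e → r (Finₚ.suc-injective e)) y≼) ∷ Sorted-merge s xs≼ ys≼

  module _ (L d : ℕ) where

    block : ∀ k → Fin (blockCount L d k) → Vec (Fin k × Fin (suc d)) (k * L)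
    block zero    i = []
    block (suc k) i =
      let s , i′ = remQuot (paths L d * blockCount L d k) i
          h , i″ = remQuot (blockCount L d k) i′
      in merge (shuffle L (k * L) (L + k * L) refl s) (heights (shuffle L d (L + d) refl h)) (block k i″)

    block-sorted : ∀ k i → Sorted Fin._≤_ (block k i)
    block-sorted zero    i = []
    block-sorted (suc k) i = Sorted-merge (shuffle L (k * L) _ refl _) (heights-increasing (shuffle L d _ refl _)) (block-sorted k _)

    block-injective : ∀ k → Injective _≡_ _≡_ (block k)
    block-injective zero    {Fin.zero} {Fin.zero} e = refl
    block-injective (suc k) {i} {j} e =
      let s≡ , h≡ , b≡ = merge-injective (shuffle L (k * L) _ refl _) (shuffle L (k * L) _ refl _) e in
      remQuot-injective {paths L (k * L)} _ (cong₂ _,_ (shuffle-injective L (k * L) _ refl s≡)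
        (remQuot-injective {paths L d} _ (cong₂ _,_ (shuffle-injective L d _ refl (heights-injective h≡))
          (block-injective k b≡))))

  AllPairs-lookup : ∀ {R : Rel X 0ℓ} {v : Vec X n} → AllPairs R v → ∀ {i j} → i Fin.< j → R (lookup v i) (lookup v j)
  AllPairs-lookup (r ∷ rs) {Fin.zero}  {Fin.suc j} i<j       = Allₚ.lookup⁺ r j
  AllPairs-lookup (r ∷ rs) {Fin.suc i} {Fin.suc j} (s≤s i<j) = AllPairs-lookup rs i<j

  -- Pigeonhole: among `suc k` positions two share one of the `k` colours, and along a colour the
  -- letters weakly increase.
  Sorted⇒¬HasDecreasing : ∀ {m} (w : Word m n) (v : Vec (Fin k × ℕ) n) →
    (∀ i → toℕ (w i) ≡ proj₂ (lookup v i)) → Sorted _≤_ v → ¬ HasDecreasing (suc k) w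
  Sorted⇒¬HasDecreasing {k = k} w v w≡v sorted (i , mono , decr) =
    let p , q , p<q , same = Finₚ.pigeonhole (n<1+n k) (proj₁ ∘ lookup v ∘ i) in
    <⇒≱ (decr p<q) (subst₂ _≤_ (sym (w≡v (i p))) (sym (w≡v (i q)))
      (AllPairs-lookup sorted (mono p<q) same))

  -- Concatenation of shifted blocks.

  module _ {k d : ℕ} where

    private D = suc d

    -- In block b, the letters of colour c lie between (b + c) * D and (b + c + 1) * D.
    letter : ℕ → Fin k × Fin D → Fin k × ℕ
    letter b (c , y) = c , toℕ (combine c y) + b * D

    letter≡ : ∀ b (c : Fin k) (y : Fin D) → toℕ (combine c y) + b * D ≡ (b + toℕ c) * D + toℕ y
    letter≡ b c y = trans (cong (_+ b * D) (Finₚ.toℕ-combine {k} {D} c y)) (lemma D (toℕ c) (toℕ y) b)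
      where
      lemma : ∀ D c y b → D * c + y + b * D ≡ (b + c) * D + y
      lemma = solve-∀

    letter-≥ : ∀ b x → (b + toℕ (proj₁ x)) * D ≤ proj₂ (letter b x)
    letter-≥ b (c , y) = ≤-trans (m≤m+n _ (toℕ y)) (≤-reflexive (sym (letter≡ b c y)))

    letter-< : ∀ b x → proj₂ (letter b x) < (suc b + toℕ (proj₁ x)) * D
    letter-< b (c , y) = begin-strict
      toℕ (combine c y) + b * D ≡⟨ letter≡ b c y ⟩
      (b + toℕ c) * D + toℕ y   <⟨ +-monoʳ-< ((b + toℕ c) * D) (Finₚ.toℕ<n y) ⟩
      (b + toℕ c) * D + D       ≡⟨ +-comm _ D ⟩
      (suc b + toℕ c) * D       ∎
      where open ≤-Reasoning

    -- Within one block the colours occupy disjoint intervals, so the bare letter determines its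
    -- colour.
    letter-injective : ∀ b → Injective _≡_ _≡_ (proj₂ ∘ letter b)
    letter-injective b {c , y} {c′ , y′} e =
      let c≡ , y≡ = Finₚ.combine-injective c y c′ y′ (Finₚ.toℕ-injective (+-cancelʳ-≡ (b * D) _ _ e))
      in cong₂ _,_ c≡ y≡

    letter-mono : ∀ b x y → (proj₁ x ≡ proj₁ y → proj₂ x Fin.≤ proj₂ y) →
      proj₁ x ≡ proj₁ y → proj₂ (letter b x) ≤ proj₂ (letter b y)
    letter-mono b (c , x) (.c , y) x≤y refl = begin
      toℕ (combine c x) + b * D ≡⟨ letter≡ b c x ⟩
      (b + toℕ c) * D + toℕ x   ≤⟨ +-monoʳ-≤ ((b + toℕ c) * D) (x≤y refl) ⟩
      (b + toℕ c) * D + toℕ y   ≡⟨ letter≡ b c y ⟨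
      toℕ (combine c y) + b * D ∎
      where open ≤-Reasoning

  module _ {k ℓ M d : ℕ} (blocks : Fin M → Vec (Fin k × Fin (suc d)) ℓ)
    (blocks-injective : Injective _≡_ _≡_ blocks) (blocks-sorted : ∀ i → Sorted Fin._≤_ (blocks i)) where

    private D = suc d

    body : ∀ {N} → ℕ → Vec (Fin M) N → Vec (Fin k × ℕ) (N * ℓ)
    body b []       = []
    body b (i ∷ is) = Vec.map (letter b) (blocks i) Vec.++ body (suc b) is

    -- Colours are dropped first, since the words that are counted carry none.
    body-injective : ∀ {N} b {is js : Vec (Fin M) N} →
      Vec.map proj₂ (body b is) ≡ Vec.map proj₂ (body b js) → is ≡ js
    body-injective b {[]}     {[]}     e = refl
    body-injective b {i ∷ is} {j ∷ js} e =
      let i≡ , is≡ = Vecₚ.++-injective _ _ (trans (sym (split i is)) (trans e (split j js))) in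
      cong₂ _∷_ (blocks-injective (map-injective (letter-injective b) i≡)) (body-injective (suc b) is≡)
      where
      split : ∀ {N} i (is : Vec (Fin M) N) → Vec.map proj₂ (body b (i ∷ is)) ≡
        Vec.map (proj₂ ∘ letter b) (blocks i) Vec.++ Vec.map proj₂ (body (suc b) is)
      split i is = trans (Vecₚ.map-++ proj₂ (Vec.map (letter b) (blocks i)) (body (suc b) is))
        (cong (Vec._++ _) (sym (Vecₚ.map-∘ proj₂ (letter b) (blocks i))))

    body-≥ : ∀ {N} b (is : Vec (Fin M) N) → All (λ (c , x) → (b + toℕ c) * D ≤ x) (body b is)
    body-≥ b []       = []
    body-≥ b (i ∷ is) = Allₚ.++⁺ (Allₚ.map⁺ (All.universal (letter-≥ b) (blocks i)))
      (All.map (≤-trans (m≤n+m _ D)) (body-≥ (suc b) is))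

    body-< : ∀ {N} b (is : Vec (Fin M) N) → All (λ (c , x) → x < (b + N + k) * D) (body b is)
    body-< b []               = []
    body-< {suc N} b (i ∷ is) = Allₚ.++⁺
      (Allₚ.map⁺ (All.universal (λ (c , y) → <-≤-trans (letter-< b (c , y)) (*-monoˡ-≤ D
        (+-mono-≤ (≤-trans (m≤m+n (suc b) N) (≤-reflexive (sym (+-suc b N)))) (<⇒≤ (Finₚ.toℕ<n c))))) (blocks i)))
      (All.map (λ {(_ , x)} → subst (λ z → x < (z + k) * D) (sym (+-suc b N))) (body-< (suc b) is))

    -- The interval of a colour in one block ends where its interval in the next block begins.
    -- Intervals of different colours may coincide between blocks, which saves letters and does no
    -- harm.
    body-sorted : ∀ {N} b (is : Vec (Fin M) N) → Sorted _≤_ (body b is)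
    body-sorted b []       = []
    body-sorted b (i ∷ is) = AllPairsₚ.++⁺
      (AllPairsₚ.map⁺ (AllPairs.map (λ {x} {y} → letter-mono b x y) (blocks-sorted i)))
      (body-sorted (suc b) is)
      (Allₚ.map⁺ (All.universal (λ x → All.map (λ { ≤z refl → ≤-trans (<⇒≤ (letter-< b x)) ≤z })
        (body-≥ (suc b) is)) (blocks i)))

    module _ .{{_ : NonZero k}} where

      -- Copies of the least letter in front, all of the first colour, fill the word up to length
      -- `n` and keep every colour sorted.
      padded : ∀ {N} p → Vec (Fin M) N → Vec (Fin k × ℕ) (p + N * ℓ)
      padded zero    is = body 0 is
      padded (suc p) is = (fromℕ< (>-nonZero⁻¹ k) , 0) ∷ padded p is

      padded-injective : ∀ {N} p {is js : Vec (Fin M) N} →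
        Vec.map proj₂ (padded p is) ≡ Vec.map proj₂ (padded p js) → is ≡ js
      padded-injective zero    e = body-injective 0 e
      padded-injective (suc p) e = padded-injective p (Vecₚ.∷-injectiveʳ e)

      padded-sorted : ∀ {N} p (is : Vec (Fin M) N) → Sorted _≤_ (padded p is)
      padded-sorted zero    is = body-sorted 0 is
      padded-sorted (suc p) is = All.universal (λ _ _ → z≤n) _ ∷ padded-sorted p is

      padded-< : ∀ {N} p (is : Vec (Fin M) N) → All (λ (c , x) → x < (N + k) * suc d) (padded p is)
      padded-< zero    is = body-< 0 is
      padded-< {N} (suc p) is = *-mono-≤ (≤-trans (>-nonZero⁻¹ k) (m≤n+m k N)) (s≤s (z≤n {d})) ∷ padded-< p is

      word : ∀ {m N} p → (N + k) * D ≤ m → Vec (Fin M) N → Word m (p + N * ℓ)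
      word p h is i = fromℕ< (<-≤-trans (Allₚ.lookup⁺ (padded-< p is) i) h)

      toℕ-word : ∀ {m N} p (h : (N + k) * D ≤ m) (is : Vec (Fin M) N) i →
        toℕ (word p h is i) ≡ proj₂ (lookup (padded p is) i)
      toℕ-word p h is i = Finₚ.toℕ-fromℕ< _

      word-injective : ∀ {m N} p (h : (N + k) * D ≤ m) {is js : Vec (Fin M) N} →
        (∀ i → word p h is i ≡ word p h js i) → is ≡ js
      word-injective p h {is} {js} e = padded-injective p (begin
        Vec.map proj₂ (padded p is)                    ≡⟨ Vecₚ.tabulate∘lookup _ ⟨
        tabulate (lookup (Vec.map proj₂ (padded p is))) ≡⟨ Vecₚ.tabulate-cong same ⟩
        tabulate (lookup (Vec.map proj₂ (padded p js))) ≡⟨ Vecₚ.tabulate∘lookup _ ⟩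
        Vec.map proj₂ (padded p js)                    ∎)
        where
        open ≡-Reasoning
        same : ∀ i → lookup (Vec.map proj₂ (padded p is)) i ≡ lookup (Vec.map proj₂ (padded p js)) i
        same i = begin
          lookup (Vec.map proj₂ (padded p is)) i ≡⟨ Vecₚ.lookup-map i proj₂ (padded p is) ⟩
          proj₂ (lookup (padded p is) i)         ≡⟨ toℕ-word p h is i ⟨
          toℕ (word p h is i)                    ≡⟨ cong toℕ (e i) ⟩
          toℕ (word p h js i)                    ≡⟨ toℕ-word p h js i ⟩
          proj₂ (lookup (padded p js) i)         ≡⟨ Vecₚ.lookup-map i proj₂ (padded p js) ⟨
          lookup (Vec.map proj₂ (padded p js)) i ∎

      ^≤wordCount : ∀ n N → (N + k) * D ≤ n → N * ℓ ≤ n → M ^ N ≤ wordCount n k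
      -- `count` is general in `n`, so that `n` can be replaced by `p + N * ℓ` through matching on
      -- `refl`.
      ^≤wordCount n N letters≤n length≤n = count (n ∸ N * ℓ) (sym (m∸n+n≡m length≤n)) letters≤n
        where
        count : ∀ {n} p → n ≡ p + N * ℓ → (N + k) * D ≤ n → M ^ N ≤ wordCount n k
        count {n} p refl h = subst (_≤ wordCount n k) (length-tabulate id)
          (length-≤ code (Unique.allFin⁺ (M ^ N)) code-injective
            (λ {i} _ → ∈-filter⁺ avoids? (∈-allFin (code i)) (avoids i)))
          where
          avoids? = λ c → ¬? (hasDecreasing? (suc k) (finToFun {n} {n} c))
          choice : Fin (M ^ N) → Vec (Fin M) N
          choice i = tabulate (finToFun {M} {N} i)
          choice-injective : Injective _≡_ _≡_ choice
          choice-injective {i} {j} e = finToFun-injective {M} {N} λ x →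
            trans (sym (Vecₚ.lookup∘tabulate _ x)) (trans (cong (λ v → lookup v x) e) (Vecₚ.lookup∘tabulate _ x))
          code : Fin (M ^ N) → Fin (n ^ n)
          code i = funToFin (word p h (choice i))
          decode : ∀ i x → finToFun (code i) x ≡ word p h (choice i) x
          decode i = Finₚ.finToFun-funToFin (word p h (choice i))
          code-injective : Injective _≡_ _≡_ code
          code-injective {i} {j} e = choice-injective (word-injective p h λ x →
            trans (sym (decode i x)) (trans (cong (λ c → finToFun c x) e) (decode j x)))
          avoids : ∀ i → ¬ HasDecreasing (suc k) (finToFun (code i))
          avoids i = Sorted⇒¬HasDecreasing (finToFun (code i)) (padded p (choice i))
            (λ x → trans (cong toℕ (decode i x)) (toℕ-word p h (choice i) x)) (padded-sorted p (choice i))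

  -- With `d ≡ k * L` the intervals are one wider than a block is long, so `N` blocks fit into
  -- length `n` whenever their letters fit into the alphabet.
  wordCount-lower : ∀ k .{{_ : NonZero k}} L n N →
    (N + k) * suc (k * L) ≤ n → blockCount L (k * L) k ^ N ≤ wordCount n k
  wordCount-lower k L n N h = ^≤wordCount (block L (k * L) k) (block-injective L (k * L) k) (block-sorted L (k * L) k) n N h
    (≤-trans (*-mono-≤ (m≤m+n N k) (n≤1+n (k * L))) h)

open Counting
open import Data.Integer as ℤ using (+_; +[1+_])
import Data.Integer.Properties as ℤₚ
open import Data.Rational hiding (NonZero)
open import Data.Rational.Properties
open import Data.Rational.Solver using (module +-*-Solver)
open import Data.Rational.Unnormalised as ℚᵘ using (mkℚᵘ; *≡*; *<*)
import Data.Rational.Unnormalised.Properties as ℚᵘₚ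
open import Algebra.Definitions.RawSemiring +-*-rawSemiring using (_^_)
open import Algebra.Properties.CommutativeSemiring.Exp (CommutativeRing.commutativeSemiring +-*-commutativeRing) using (^-distrib-*)

-- Rational bounds and the limit

toℚᵘ-/ : ∀ a b .{{_ : NonZero b}} → toℚᵘ (+ a / b) ℚᵘ.≃ + a ℚᵘ./ b
toℚᵘ-/ a (suc b) = toℚᵘ-fromℚᵘ (mkℚᵘ (+ a) b)

fromℕ-* : ∀ m n → fromℕ (m ℕ.* n) ≡ fromℕ m * fromℕ n
fromℕ-* m n = toℚᵘ-injective (begin
  toℚᵘ (fromℕ (m ℕ.* n))               ≈⟨ toℚᵘ-/ (m ℕ.* n) 1 ⟩
  + (m ℕ.* n) ℚᵘ./ 1                   ≡⟨ cong (λ z → z ℚᵘ./ 1) (ℤₚ.pos-* m n) ⟩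
  (+ m ℚᵘ./ 1) ℚᵘ.* (+ n ℚᵘ./ 1)        ≈⟨ ℚᵘₚ.*-cong (toℚᵘ-/ m 1) (toℚᵘ-/ n 1) ⟨
  toℚᵘ (fromℕ m) ℚᵘ.* toℚᵘ (fromℕ n)   ≈⟨ toℚᵘ-homo-* (fromℕ m) (fromℕ n) ⟨
  toℚᵘ (fromℕ m * fromℕ n)             ∎)
  where open ℚᵘₚ.≃-Reasoning

/-*-fromℕ : ∀ a b .{{_ : NonZero b}} → (+ a / b) * fromℕ b ≡ fromℕ a
/-*-fromℕ a b@(suc _) = toℚᵘ-injective (begin
  toℚᵘ ((+ a / b) * fromℕ b)             ≈⟨ toℚᵘ-homo-* (+ a / b) (fromℕ b) ⟩
  toℚᵘ (+ a / b) ℚᵘ.* toℚᵘ (fromℕ b)     ≈⟨ ℚᵘₚ.*-cong (toℚᵘ-/ a b) (toℚᵘ-/ b 1) ⟩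
  (+ a ℚᵘ./ b) ℚᵘ.* (+ b ℚᵘ./ 1)         ≈⟨ *≡* (trans (ℤₚ.*-identityʳ (+ a ℤ.* + b)) (cong (λ z → + a ℤ.* + z) (sym (ℕₚ.*-identityʳ b)))) ⟩
  + a ℚᵘ./ 1                             ≈⟨ toℚᵘ-/ a 1 ⟨
  toℚᵘ (fromℕ a)                         ∎)
  where open ℚᵘₚ.≃-Reasoning

fromℕ-mono-< : ∀ {m n} → m ℕ.< n → fromℕ m < fromℕ n
fromℕ-mono-< {m} {n} m<n = toℚᵘ-cancel-< (ℚᵘₚ.<-respˡ-≃ (ℚᵘₚ.≃-sym (toℚᵘ-/ m 1))
  (ℚᵘₚ.<-respʳ-≃ (ℚᵘₚ.≃-sym (toℚᵘ-/ n 1)) (*<* (ℤₚ.*-monoʳ-<-pos (+ 1) (ℤ.+<+ m<n)))))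

fromℕ-mono-≤ : ∀ {m n} → m ℕ.≤ n → fromℕ m ≤ fromℕ n
fromℕ-mono-≤ m≤n with ℕₚ.m≤n⇒m<n∨m≡n m≤n
... | inj₁ m<n  = <⇒≤ (fromℕ-mono-< m<n)
... | inj₂ refl = ≤-refl

fromℕ-cancel-< : ∀ {m n} → fromℕ m < fromℕ n → m ℕ.< n
fromℕ-cancel-< h = ℕₚ.≰⇒> λ n≤m → <-irrefl refl (<-≤-trans h (fromℕ-mono-≤ n≤m))

fromℕ-^ : ∀ m n → fromℕ (m ℕ.^ n) ≡ fromℕ m ^ n
fromℕ-^ m zero    = refl
fromℕ-^ m (suc n) = trans (fromℕ-* m (m ℕ.^ n)) (cong (fromℕ m *_) (fromℕ-^ m n))

fromℕ-positive : ∀ m .{{_ : NonZero m}} → Positive (fromℕ m)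
fromℕ-positive m = normalize-pos m 1

/-^-fromℕ : ∀ a b .{{_ : NonZero b}} n → (+ a / b) ^ n * fromℕ (b ℕ.^ n) ≡ fromℕ (a ℕ.^ n)
/-^-fromℕ a b n = begin
  (+ a / b) ^ n * fromℕ (b ℕ.^ n) ≡⟨ cong ((+ a / b) ^ n *_) (fromℕ-^ b n) ⟩
  (+ a / b) ^ n * fromℕ b ^ n     ≡⟨ ^-distrib-* (+ a / b) (fromℕ b) n ⟨
  ((+ a / b) * fromℕ b) ^ n       ≡⟨ cong (_^ n) (/-*-fromℕ a b) ⟩
  fromℕ a ^ n                     ≡⟨ fromℕ-^ a n ⟨
  fromℕ (a ℕ.^ n)                 ∎
  where open ≡-Reasoning

/-^-< : ∀ a b .{{_ : NonZero b}} n w → a ℕ.^ n ℕ.< b ℕ.^ n ℕ.* w → (+ a / b) ^ n < fromℕ w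
/-^-< a b n w h = *-cancelʳ-<-nonNeg (fromℕ (b ℕ.^ n))
  {{pos⇒nonNeg (fromℕ (b ℕ.^ n)) {{fromℕ-positive (b ℕ.^ n) {{ℕₚ.m^n≢0 b n}}}}}}
  (subst₂ _<_ (sym (/-^-fromℕ a b n))
    (trans (cong fromℕ (ℕₚ.*-comm (b ℕ.^ n) w)) (fromℕ-* w (b ℕ.^ n))) (fromℕ-mono-< h))

≤-/-^ : ∀ a b .{{_ : NonZero b}} n w → w ℕ.* b ℕ.^ n ℕ.≤ a ℕ.^ n → fromℕ w ≤ (+ a / b) ^ n
≤-/-^ a b n w h = *-cancelʳ-≤-pos (fromℕ (b ℕ.^ n)) {{fromℕ-positive (b ℕ.^ n) {{ℕₚ.m^n≢0 b n}}}}
  (subst₂ _≤_ (fromℕ-* w (b ℕ.^ n)) (sym (/-^-fromℕ a b n)) (fromℕ-mono-≤ h))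

/-<⇒*-< : ∀ a b c d .{{_ : NonZero b}} .{{_ : NonZero d}} →
  + a / b < + c / d → a ℕ.* d ℕ.< b ℕ.* c
/-<⇒*-< a b c d h = fromℕ-cancel-< (subst₂ _<_ left right
  (*-monoˡ-<-pos (fromℕ b * fromℕ d)
    {{pos*pos⇒pos (fromℕ b) {{fromℕ-positive b}} (fromℕ d) {{fromℕ-positive d}}}} h))
  where
  open ≡-Reasoning
  left : (+ a / b) * (fromℕ b * fromℕ d) ≡ fromℕ (a ℕ.* d)
  left = begin
    (+ a / b) * (fromℕ b * fromℕ d) ≡⟨ *-assoc (+ a / b) (fromℕ b) (fromℕ d) ⟨
    (+ a / b) * fromℕ b * fromℕ d   ≡⟨ cong (_* fromℕ d) (/-*-fromℕ a b) ⟩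
    fromℕ a * fromℕ d               ≡⟨ fromℕ-* a d ⟨
    fromℕ (a ℕ.* d)                 ∎
  right : (+ c / d) * (fromℕ b * fromℕ d) ≡ fromℕ (b ℕ.* c)
  right = begin
    (+ c / d) * (fromℕ b * fromℕ d) ≡⟨ cong ((+ c / d) *_) (*-comm (fromℕ b) (fromℕ d)) ⟩
    (+ c / d) * (fromℕ d * fromℕ b) ≡⟨ *-assoc (+ c / d) (fromℕ d) (fromℕ b) ⟨
    (+ c / d) * fromℕ d * fromℕ b   ≡⟨ cong (_* fromℕ b) (/-*-fromℕ c d) ⟩
    fromℕ c * fromℕ b               ≡⟨ fromℕ-* c b ⟨
    fromℕ (c ℕ.* b)                 ≡⟨ cong fromℕ (ℕₚ.*-comm c b) ⟩
    fromℕ (b ℕ.* c)                 ∎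

positive⇒fraction : ∀ {q} → 0ℚ < q → ∃₂ λ a b → NonZero a × Σ (NonZero b) λ b≢0 → q ≡ (+ a / b) {{b≢0}}
positive⇒fraction {q} 0<q with q | positive 0<q
... | p@(mkℚ +[1+ n ] d _) | _ = suc n , suc d , _ , _ , sym (↥p/↧p≡p p)

^-positive : ∀ {q} n → 0ℚ < q → 0ℚ < q ^ n
^-positive zero    0<q = positive⁻¹ 1ℚ
^-positive {q} (suc n) 0<q = positive⁻¹ _ {{pos*pos⇒pos q {{positive 0<q}} (q ^ n) {{positive (^-positive n 0<q)}}}}

^-mono-< : ∀ {p q} n .{{_ : NonZero n}} → 0ℚ < p → p < q → p ^ n < q ^ n
^-mono-< {p} {q} (suc zero)      0<p p<q = subst₂ _<_ (sym (*-identityʳ p)) (sym (*-identityʳ q)) p<q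
^-mono-< {p} {q} (suc n@(suc _)) 0<p p<q = <-trans
  (*-monoʳ-<-pos p {{positive 0<p}} (^-mono-< n 0<p p<q))
  (*-monoˡ-<-pos (q ^ n) {{positive (^-positive n (<-trans 0<p p<q))}} p<q)

-- Squeezing the roots of the counts.

module _ (k : ℕ) .{{_ : NonZero k}} where

  private
    R = suc k ℕ.^ suc k
    T = k ℕ.^ (k ℕ.∸ 1)
    instance
      T≢0 : NonZero T
      T≢0 = ℕₚ.m^n≢0 k (k ℕ.∸ 1)
    r : ℚ
    r = + R / T

  0<r : 0ℚ < r
  0<r = positive⁻¹ r {{normalize-pos R T {{T≢0}} {{ℕₚ.m^n≢0 (suc k) (suc k)}}}}

  wordCount-≤ : ∀ n → fromℕ (wordCount n k) ≤ r ^ n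
  wordCount-≤ n = ≤-/-^ R T n (wordCount n k) (wordCount-upper k n)

  -- For `q ≡ a / b` the claim is an inequality between natural numbers, and `q < r` means
  -- `a * T < b * R`.
  wordCount-> : ∀ {q} → 0ℚ < q → q < r → ∃ λ N₀ → ∀ n → N₀ ℕ.≤ n → q ^ n < fromℕ (wordCount n k)
  wordCount-> {q} 0<q q<r =
    let a , b , a≢0 , b≢0 , q≡ = positive⇒fraction 0<q in bound a b a≢0 b≢0 q≡
    where
    bound : ∀ a b → NonZero a → (b≢0 : NonZero b) → q ≡ (+ a / b) {{b≢0}} →
      ∃ λ N₀ → ∀ n → N₀ ℕ.≤ n → q ^ n < fromℕ (wordCount n k)
    bound a b a≢0 b≢0 refl =
      let instance
            _ = a≢0
            _ = b≢0
          L , beats  = blockCount-beats k a b (/-<⇒*-< a b R T q<r)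
          N₀ , above = blocks⇒growth k a b (λ n → wordCount n k) (blockCount L (k ℕ.* L) k) (suc (k ℕ.* L))
                         beats (wordCount-lower k L)
      in N₀ , λ n N₀≤n → /-^-< a b n (wordCount n k) (above n N₀≤n)

  -- The upper estimate holds for every `n`; the threshold `N₀` comes from the lower one alone.
  growth-converges : growth k ConvergesTo growthRate k
  growth-converges ε 0<ε =
    -- The maximum with 0 keeps `q` positive, as `wordCount->` requires.
    let q , lower<q , q<r = <-dense {(r - ε) ⊔ 0ℚ} {r} (⊔-lub-< r-ε<r 0<r)
        N₀ , above = wordCount-> {q} (≤-<-trans (p≤q⊔p (r - ε) 0ℚ) lower<q) q<r
        -- A point strictly above `r` turns the weak bound `wordCount-≤` into the strict one that an
        -- upper cut demands.
        s , r<s , s<r+ε = <-dense {r} {r + ε} r<r+ε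
    in N₀ , λ n N₀≤n →
      ( q + ε
      , subst (_< q + ε) (cancel r ε) (+-monoˡ-< ε (≤-<-trans (p≤p⊔q (r - ε) 0ℚ) lower<q))
      , inj₂ (subst (λ x → x ^ n < fromℕ (wordCount n k)) (sym (cancel′ q ε)) (above n N₀≤n)))
      ,
      ( s
      , (<-trans 0<r r<s , ≤-<-trans (wordCount-≤ n) (^-mono-< n 0<r r<s))
      , subst (s - ε <_) (cancel′ r ε) (+-monoˡ-< (- ε) s<r+ε))
    where
    open +-*-Solver
    cancel : ∀ q ε → (q - ε) + ε ≡ q
    cancel = solve 2 (λ q ε → (q :- ε) :+ ε := q) refl
    cancel′ : ∀ q ε → (q + ε) - ε ≡ q
    cancel′ = solve 2 (λ q ε → (q :+ ε) :- ε := q) refl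
    r<r+ε : r < r + ε
    r<r+ε = subst (_< r + ε) (+-identityʳ r) (+-monoʳ-< r 0<ε)
    r-ε<r : r - ε < r
    r-ε<r = subst (r - ε <_) (cancel′ r ε) (+-monoˡ-< (- ε) r<r+ε)
    ⊔-lub-< : ∀ {p q s} → p < s → q < s → p ⊔ q < s
    ⊔-lub-< {p} {q} {s} p<s q<s with ⊔-sel p q
    ... | inj₁ e = subst (_< s) (sym e) p<s
    ... | inj₂ e = subst (_< s) (sym e) q<s

ConvergesTo⇒HasLimSup : ∀ {a ℓ} → a ConvergesTo ℓ → a HasLimSup ℓ
ConvergesTo⇒HasLimSup a→ℓ ε 0<ε =
  let N₀ , close = a→ℓ ε 0<ε in
  (N₀ , λ n N₀≤n → proj₂ (close n N₀≤n)) ,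
  -- The successor makes the index nonzero beyond both thresholds.
  λ N → suc (N ℕ.⊔ N₀) , _ , ℕₚ.≤-trans (ℕₚ.m≤m⊔n N N₀) (ℕₚ.n≤1+n _) ,
    proj₁ (close (suc (N ℕ.⊔ N₀)) (ℕₚ.≤-trans (ℕₚ.m≤n⊔m N N₀) (ℕₚ.n≤1+n _)))

theorem3p4 : (k : ℕ) .{{_ : NonZero k}} →
    (∃ λ ℓ → growth k ConvergesTo ℓ) × growth k HasLimSup growthRate k
theorem3p4 k = (growthRate k , growth-converges k) , ConvergesTo⇒HasLimSup {growth k} {growthRate k} (growth-converges k)
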